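{- Let $G_1$ be an $r_1$-regular graph on $n_1$ vertices and $G_2$ an arbitrary graph on $n_2$ vertices, where $n_1 \geq 2$, $n_2 \geq 1$ and $r_1 \geq 1$, and let $\nu_1(G_1)\le\dots\le\nu_{n_1}(G_1)$ be the eigenvalues of $Q(G_1)$. Then $$\phi(Q(G_1 \star G_2); x) = (\phi(Q(G_2); x - r_1))^{n_1} \cdot \prod_{i=1}^{n_1} \left(x - n_2 r_1 - \nu_i(G_1) - \Gamma_{Q(G_2)}(x - r_1)\,(\nu_i(G_1) - r_1)^2\right).$$
   Context: All graphs are finite, undirected and simple. For a graph $G$, $A(G)$ is its adjacency matrix, $D(G)$ the diagonal matrix of vertex degrees, and $Q(G)=D(G)+A(G)$ its signless Laplacian matrix. For a square matrix $M$ of order $n$, $\phi(M;x)=\det(xI_n-M)$, and the $M$-coronal is the rational function $\Gamma_M(x)=\mathbf{1}_n^T(xI_n-M)^{ -1}\mathbf{1}_n$ with $\mathbf{1}_n$ the all-ones column vector. The neighbourhood corona $G_1\star G_2$ of graphs $G_1$ (with vertices $v_1,\dots,v_{n_1}$) and $G_2$ is the graph obtained by taking one copy of $G_1$ and $n_1$ copies of $G_2$, all vertex-disjoint, and joining every neighbour (in $G_1$) of $v_i$ to every vertex of the $i$th copy of $G_2$ by a new edge, for each $i$. The identity is one of rational functions in $x$. -}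

module Defs where

open import Level using (Level; _⊔_) renaming (suc to lsuc)
open import Data.Nat using (ℕ; zero; suc) renaming (_+_ to _+ℕ_; _*_ to _*ℕ_)
open import Data.Nat.Base using (_≡ᵇ_)
open import Data.Bool using (Bool; true; false; if_then_else_; _∧_)
open import Data.Fin using (Fin; zero; suc; toℕ; splitAt; remQuot; punchIn; _≟_)
open import Data.Sum using (inj₁; inj₂)
open import Data.Product using (_,_)
open import Relation.Nullary using (¬_; does)
open import Relation.Binary.PropositionalEquality using (_≡_)
open import Algebra.Bundles using (CommutativeRing)

record Graph (n : ℕ) : Set where
  field
    adj    : Fin n → Fin n → Bool
    sym    : ∀ i j → adj i j ≡ adj j i
    irrefl : ∀ i → adj i i ≡ false
open Graph public

sumℕ : ∀ n → (Fin n → ℕ) → ℕ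
sumℕ zero    f = 0
sumℕ (suc n) f = f zero +ℕ sumℕ n (λ i → f (suc i))

degreeOf : ∀ {n} → (Fin n → Fin n → Bool) → Fin n → ℕ
degreeOf {n} a i = sumℕ n (λ j → if a i j then 1 else 0)

degree : ∀ {n} → Graph n → Fin n → ℕ
degree G = degreeOf (adj G)

Regular : ∀ {n} → ℕ → Graph n → Set
Regular r G = ∀ i → degree G i ≡ r

-- Neighbourhood corona G1 ⋆ G2.
-- Vertex set Fin (n1 + n1 * n2): the first n1 vertices are the vertices
-- v_1..v_{n1} of G1; vertex n1 ↑ʳ combine i j is vertex j of the i-th
-- copy of G2.

coronaAdj : ∀ {n1 n2} → Graph n1 → Graph n2 →
            Fin (n1 +ℕ n1 *ℕ n2) → Fin (n1 +ℕ n1 *ℕ n2) → Bool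
coronaAdj {n1} {n2} G1 G2 u v with splitAt n1 u | splitAt n1 v
... | inj₁ a | inj₁ b = adj G1 a b
... | inj₁ a | inj₂ k with remQuot {n1} n2 k
...   | (i , _) = adj G1 a i
coronaAdj {n1} {n2} G1 G2 u v | inj₂ k | inj₁ b with remQuot {n1} n2 k
...   | (i , _) = adj G1 i b
coronaAdj {n1} {n2} G1 G2 u v | inj₂ k | inj₂ l with remQuot {n1} n2 k | remQuot {n1} n2 l
...   | (i , j) | (i' , j') = does (i ≟ i') ∧ adj G2 j j'

QOf : ∀ {n} → (Fin n → Fin n → Bool) → Fin n → Fin n → ℕ
QOf a i j = (if does (i ≟ j) then degreeOf a i else 0) +ℕ (if a i j then 1 else 0)

Q : ∀ {n} → Graph n → Fin n → Fin n → ℕ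
Q G = QOf (adj G)

Qcorona : ∀ {n1 n2} → Graph n1 → Graph n2 →
          Fin (n1 +ℕ n1 *ℕ n2) → Fin (n1 +ℕ n1 *ℕ n2) → ℕ
Qcorona G1 G2 = QOf (coronaAdj G1 G2)

record Field c ℓ : Set (lsuc (c ⊔ ℓ)) where
  field
    commutativeRing : CommutativeRing c ℓ
  open CommutativeRing commutativeRing public
  field
    0≉1     : ¬ (0# ≈ 1#)
    inverse : ∀ x → ¬ (x ≈ 0#) → Carrier
    inverseʳ : ∀ x (p : ¬ (x ≈ 0#)) → (x * inverse x p) ≈ 1#

module FieldOps {c ℓ} (F : Field c ℓ) where
  open Field F public using (Carrier; _≈_; _+_; _*_; -_; 0#; 1#)

  _−_ : Carrier → Carrier → Carrier
  x − y = x + (- y)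

  fromℕ : ℕ → Carrier
  fromℕ zero    = 0#
  fromℕ (suc n) = 1# + fromℕ n

  CharZero : Set ℓ
  CharZero = ∀ m n → fromℕ m ≈ fromℕ n → m ≡ n

  _^_ : Carrier → ℕ → Carrier
  x ^ zero  = 1#
  x ^ suc n = x * (x ^ n)

  Σ : ∀ n → (Fin n → Carrier) → Carrier
  Σ zero    f = 0#
  Σ (suc n) f = f zero + Σ n (λ i → f (suc i))

  Π : ∀ n → (Fin n → Carrier) → Carrier
  Π zero    f = 1#
  Π (suc n) f = f zero * Π n (λ i → f (suc i))

  Mat : ℕ → Set c
  Mat n = Fin n → Fin n → Carrier

  matℕ : ∀ {n} → (Fin n → Fin n → ℕ) → Mat n
  matℕ M i j = fromℕ (M i j)

  I : ∀ {n} → Mat n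
  I i j = if does (i ≟ j) then 1# else 0#

  _·_ : ∀ {n} → Mat n → Mat n → Mat n
  _·_ {n} M N i j = Σ n (λ k → M i k * N k j)

  _≈ₘ_ : ∀ {n} → Mat n → Mat n → Set ℓ
  M ≈ₘ N = ∀ i j → M i j ≈ N i j

  charMat : ∀ {n} → Carrier → Mat n → Mat n
  charMat x M i j = (if does (i ≟ j) then x else 0#) − M i j

  sgn : ℕ → Carrier
  sgn zero          = 1#
  sgn (suc zero)    = - 1#
  sgn (suc (suc k)) = sgn k

  det : ∀ {n} → Mat n → Carrier
  det {zero}  M = 1#
  det {suc n} M = Σ (suc n) (λ j → sgn (toℕ j) * (M zero j * det (λ a b → M (suc a) (punchIn j b))))

  φ : ∀ {n} → Mat n → Carrier → Carrier
  φ M x = det (charMat x M)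

  IsResolvent : ∀ {n} → Mat n → Carrier → Mat n → Set ℓ
  IsResolvent M x N = ((charMat x M · N) ≈ₘ I) Data.Product.× ((N · charMat x M) ≈ₘ I)

  sumEntries : ∀ {n} → Mat n → Carrier
  sumEntries {n} N = Σ n (λ i → Σ n (λ j → N i j))

{-# OPTIONS --safe #-}
-- Ordering the vertices as in the corona, the characteristic matrix is the block matrix with
-- diagonal blocks (x − r₁ − n₂r₁)I − A and I ⊗ C, where A is the adjacency matrix of G₁ and C the
-- characteristic matrix of Q(G₂) at x − r₁. The Schur complement of I ⊗ C is
-- (x − r₁ − n₂r₁)I − A − s A², where s is the sum of the entries of C⁻¹.
--
-- It remains to show det (eI − M − sM²) = ∏ (e − mᵢ − s mᵢ²) when the characteristic polynomial of
-- M splits. The field need not contain the roots of the quadratic e − t − st², and equality in it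
-- is not decidable. But for e = k + sk² the quadratic has the root k, so that there the identity
-- follows from multiplicativity of det; as both sides are polynomial in e and the characteristic
-- is zero, this implies it for every e.

module Submission where

open import Defs renaming (sym to adj-sym)
open import Level using (_⊔_)
open import Data.Nat using (ℕ; zero; suc; _≤_) renaming (_+_ to _+ℕ_; _*_ to _*ℕ_)
open import Data.Fin using (Fin; zero; suc; toℕ; punchIn; punchOut; splitAt; remQuot; combine; _↑ˡ_; _↑ʳ_; _≟_)
open import Data.Nat.Properties using (+-suc; suc-injective; m≢1+m+n) renaming (+-identityʳ to +-identityʳℕ)
open import Data.Fin.Properties using (punchIn-injective; punchInᵢ≢i; punchIn-punchOut; toℕ-↑ˡ; splitAt-↑ˡ; splitAt-↑ʳ; splitAt⁻¹-↑ˡ; splitAt⁻¹-↑ʳ; combine-remQuot; remQuot-combine; ↑ˡ-injective; ↑ʳ-injective; combine-injective)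
open import Data.List using (List; []; map; length) renaming (_∷_ to _∷ₗ_)
open import Data.Sum using (inj₁; inj₂; [_,_]′)
open import Data.Bool using (Bool; true; false; if_then_else_; _∧_)
open import Data.Product using (_×_; _,_; proj₁; proj₂; ∃)
open import Data.Vec.Functional using (_∷_; insertAt)
open import Data.Vec.Functional.Properties using (insertAt-lookup; insertAt-punchIn)
open import Data.Unit.Polymorphic using (⊤; tt)
open import Function using (_∘_; mk⇔)
open import Relation.Nullary using (¬_; yes; no; does)
open import Relation.Nullary.Decidable using (dec-true; dec-false; does-⇔)
open import Relation.Binary.PropositionalEquality as ≡ using (_≡_; _≢_)
import Algebra.Properties.Ring
import Algebra.Solver.Ring.NaturalCoefficients.Default
import Relation.Binary.Reasoning.Setoid

-- `det` is given only by expansion along the first row, so its theory rests on one uniqueness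
-- statement: an alternating multilinear function of the rows is `det` times its value at `I`.
-- Multiplicativity is the case of the function det (M · N) of M. The hypothesis on eigenvalues
-- concerns det (yI - M) alone, whereas the second factor of the quadratic is (1 + s k) I + s M. Its
-- leading coefficient s may vanish, and no case distinction on this is available. Hence det (aI +
-- bM) is found for b a positive integer, where division by b is possible, and carried to all b
-- because both sides are polynomials in b. The values k + s k² need not exhaust the field either;
-- what is used is that a polynomial vanishing at all of them vanishes everywhere.

module FieldTheory {c ℓ} (F : Field c ℓ) where
  open FieldOps F renaming (_−_ to infixl 6 _−_; _^_ to infixr 8 _^_)
  open Field F using
    ( setoid; ring; commutativeSemiring; refl; sym; trans; reflexive
    ; +-cong; +-congˡ; +-congʳ; *-cong; *-congˡ; *-congʳ; -‿cong
    ; +-comm; +-assoc; *-comm; *-assoc; +-identityˡ; +-identityʳ; *-identityˡ; *-identityʳ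
    ; zeroˡ; zeroʳ; distribˡ; distribʳ; -‿inverseˡ; -‿inverseʳ; inverse; inverseʳ )
  open Algebra.Properties.Ring ring
    using (-‿distribˡ-*; -‿distribʳ-*; -‿involutive; -‿+-comm; +-inverseˡ-unique; -1*x≈-x)
  open Algebra.Solver.Ring.NaturalCoefficients.Default commutativeSemiring
    using (solve; _:+_; _:*_; _:=_; con)
  open Relation.Binary.Reasoning.Setoid setoid

  ⟦_⟧ : Bool → Carrier
  ⟦ b ⟧ = if b then 1# else 0#

  -- Finite sums

  Σ-cong : ∀ n {f g : Fin n → Carrier} → (∀ i → f i ≈ g i) → Σ n f ≈ Σ n g
  Σ-cong zero    p = refl
  Σ-cong (suc n) p = +-cong (p zero) (Σ-cong n (p ∘ suc))

  Σ-zero : ∀ n {f : Fin n → Carrier} → (∀ i → f i ≈ 0#) → Σ n f ≈ 0#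
  Σ-zero zero    p = refl
  Σ-zero (suc n) p = trans (+-cong (p zero) (Σ-zero n (p ∘ suc))) (+-identityˡ 0#)

  Σ-+ : ∀ n (f g : Fin n → Carrier) → Σ n (λ i → f i + g i) ≈ Σ n f + Σ n g
  Σ-+ zero    f g = sym (+-identityˡ 0#)
  Σ-+ (suc n) f g = trans (+-congˡ (Σ-+ n (f ∘ suc) (g ∘ suc)))
    (solve 4 (λ a b s t → (a :+ b) :+ (s :+ t) := (a :+ s) :+ (b :+ t)) refl _ _ _ _)

  *-Σ : ∀ n a (f : Fin n → Carrier) → a * Σ n f ≈ Σ n (λ i → a * f i)
  *-Σ zero    a f = zeroʳ a
  *-Σ (suc n) a f = trans (distribˡ a _ _) (+-congˡ (*-Σ n a (f ∘ suc)))

  Σ-* : ∀ n (f : Fin n → Carrier) a → Σ n f * a ≈ Σ n (λ i → f i * a)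
  Σ-* zero    f a = zeroˡ a
  Σ-* (suc n) f a = trans (distribʳ a _ _) (+-congˡ (Σ-* n (f ∘ suc) a))

  Σ-swap : ∀ m n (f : Fin m → Fin n → Carrier) →
           Σ m (λ i → Σ n (f i)) ≈ Σ n (λ j → Σ m (λ i → f i j))
  Σ-swap zero    n f = sym (Σ-zero n (λ _ → refl))
  Σ-swap (suc m) n f = trans (+-congˡ (Σ-swap m n (f ∘ suc))) (sym (Σ-+ n _ _))

  Σ-split : ∀ m n (f : Fin (m +ℕ n) → Carrier) →
            Σ (m +ℕ n) f ≈ Σ m (λ i → f (i ↑ˡ n)) + Σ n (λ j → f (m ↑ʳ j))
  Σ-split zero    n f = sym (+-identityˡ _)
  Σ-split (suc m) n f = trans (+-congˡ (Σ-split m n (f ∘ suc))) (sym (+-assoc _ _ _))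

  Σ-combine : ∀ m n (f : Fin (m *ℕ n) → Carrier) →
              Σ (m *ℕ n) f ≈ Σ m (λ i → Σ n (λ j → f (combine i j)))
  Σ-combine zero    n f = refl
  Σ-combine (suc m) n f =
    trans (Σ-split n (m *ℕ n) f) (+-congˡ (Σ-combine m n (λ k → f (n ↑ʳ k))))

  Σ-Iˡ : ∀ n i (f : Fin n → Carrier) → Σ n (λ k → I i k * f k) ≈ f i
  Σ-Iˡ (suc n) zero    f =
    trans (+-cong (*-identityˡ _) (Σ-zero n (λ _ → zeroˡ _))) (+-identityʳ _)
  Σ-Iˡ (suc n) (suc i) f =
    trans (+-cong (zeroˡ _) (Σ-Iˡ n i (f ∘ suc))) (+-identityˡ _)

  I-sym : ∀ {n} (i j : Fin n) → I i j ≈ I j i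
  I-sym i j = reflexive (≡.cong ⟦_⟧
    (does-⇔ (mk⇔ ≡.sym ≡.sym) (i ≟ j) (j ≟ i)))

  Σ-Iʳ : ∀ n j (f : Fin n → Carrier) → Σ n (λ k → f k * I k j) ≈ f j
  Σ-Iʳ n j f = trans (Σ-cong n (λ k → trans (*-comm _ _) (*-congʳ (I-sym k j)))) (Σ-Iˡ n j f)

  Π-cong : ∀ n {f g : Fin n → Carrier} → (∀ i → f i ≈ g i) → Π n f ≈ Π n g
  Π-cong zero    p = refl
  Π-cong (suc n) p = *-cong (p zero) (Π-cong n (p ∘ suc))

  Π-* : ∀ n (f g : Fin n → Carrier) → Π n f * Π n g ≈ Π n (λ i → f i * g i)
  Π-* zero    f g = *-identityˡ 1#
  Π-* (suc n) f g = trans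
    (solve 4 (λ a s b t → (a :* s) :* (b :* t) := (a :* b) :* (s :* t)) refl _ _ _ _)
    (*-congˡ (Π-* n (f ∘ suc) (g ∘ suc)))

  -- Determinants as alternating forms

  sgn-suc : ∀ k → sgn (suc k) ≈ - sgn k
  sgn-suc zero          = refl
  sgn-suc (suc zero)    = sym (-‿involutive 1#)
  sgn-suc (suc (suc k)) = sgn-suc k

  det-cong : ∀ {n} {M N : Mat n} → M ≈ₘ N → det M ≈ det N
  det-cong {zero}  p = refl
  det-cong {suc n} p = Σ-cong (suc n) (λ j →
    *-congˡ {x = sgn (toℕ j)} (*-cong (p zero j) (det-cong (λ a b → p (suc a) (punchIn j b)))))

  Row : ℕ → Set c
  Row n = Fin n → Carrier

  Rows : ℕ → ℕ → Set c
  Rows m n = Fin m → Row n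

  _≈ᵣ_ : ∀ {m n} → Rows m n → Rows m n → Set ℓ
  A ≈ᵣ B = ∀ i j → A i j ≈ B i j

  Congruent : ∀ {m n} → (Rows m n → Carrier) → Set (c ⊔ ℓ)
  Congruent f = ∀ {A B} → A ≈ᵣ B → f A ≈ f B

  record IsLinear {n} (f : Row n → Carrier) : Set (c ⊔ ℓ) where
    field
      cong : ∀ {u v} → (∀ i → u i ≈ v i) → f u ≈ f v
      +-homo : ∀ u v → f (λ i → u i + v i) ≈ f u + f v
      *-homo : ∀ a v → f (λ i → a * v i) ≈ a * f v

    0-homo : f (λ _ → 0#) ≈ 0#
    0-homo = trans (cong (λ _ → sym (zeroˡ 0#))) (trans (*-homo 0# _) (zeroˡ _))

    +*-homo : ∀ u a v → f (λ i → u i + a * v i) ≈ f u + a * f v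
    +*-homo u a v = trans (+-homo u _) (+-congˡ (*-homo a v))

    Σ-homo : ∀ m (a : Fin m → Carrier) (u : Fin m → Row n) →
             f (λ i → Σ m (λ j → a j * u j i)) ≈ Σ m (λ j → a j * f (u j))
    Σ-homo zero    a u = 0-homo
    Σ-homo (suc m) a u =
      trans (+-homo _ _) (+-cong (*-homo (a zero) (u zero)) (Σ-homo m (a ∘ suc) (u ∘ suc)))

  open IsLinear

  -- Defined by cases because a single row has no neighbour to be compared with; proofs about it
  -- therefore split on `m` as well.
  HeadVanishing : ∀ m {n} → (Rows (suc m) n → Carrier) → Set (c ⊔ ℓ)
  HeadVanishing zero    f = ⊤
  HeadVanishing (suc m) f = ∀ v B → f (v ∷ v ∷ B) ≈ 0#

  -- Vanishing is only required for two equal adjacent rows, which suffices by multilinearity.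
  Alternating : ∀ m {n} → (Rows m n → Carrier) → Set (c ⊔ ℓ)
  Alternating zero    f = Congruent f
  Alternating (suc m) f =
    Congruent f × (∀ B → IsLinear (λ v → f (v ∷ B))) × HeadVanishing m f
      × (∀ v → Alternating m (λ B → f (v ∷ B)))

  alt-congruent : ∀ m {n} {f : Rows m n → Carrier} → Alternating m f → Congruent f
  alt-congruent zero    p = p
  alt-congruent (suc m) p = proj₁ p

  linear-resp : ∀ {n} {f g : Row n → Carrier} → (∀ v → f v ≈ g v) → IsLinear f → IsLinear g
  linear-resp e p = record
    { cong   = λ q → trans (sym (e _)) (trans (cong p q) (e _))
    ; +-homo = λ u v → trans (sym (e _)) (trans (+-homo p u v) (+-cong (e u) (e v)))
    ; *-homo = λ a v → trans (sym (e _)) (trans (*-homo p a v) (*-congˡ (e v)))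
    }

  linear-Σ : ∀ {n} k (a : Fin k → Carrier) {f : Fin k → Row n → Carrier} →
             (∀ j → IsLinear (f j)) → IsLinear (λ v → Σ k (λ j → a j * f j v))
  linear-Σ k a p = record
    { cong   = λ q → Σ-cong k (λ j → *-congˡ {x = a j} (cong (p j) q))
    ; +-homo = λ u v → trans
        (Σ-cong k (λ j → trans (*-congˡ (+-homo (p j) u v)) (distribˡ (a j) _ _))) (Σ-+ k _ _)
    ; *-homo = λ b v → trans
        (Σ-cong k (λ j → trans (*-congˡ (*-homo (p j) b v))
          (solve 3 (λ x y z → x :* (y :* z) := y :* (x :* z)) refl _ _ _)))
        (sym (*-Σ k b _))
    }

  linear-coord : ∀ {n} (j : Fin n) a → IsLinear (λ v → v j * a)
  linear-coord j a = record
    { cong   = λ q → *-congʳ (q j)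
    ; +-homo = λ u v → distribʳ a _ _
    ; *-homo = λ b v → *-assoc b _ a
    }

  alt-resp : ∀ m {n} {f g : Rows m n → Carrier} → (∀ A → f A ≈ g A) →
             Alternating m f → Alternating m g
  alt-resp zero    e p = λ q → trans (sym (e _)) (trans (p q) (e _))
  alt-resp (suc m) {f = f} {g} e (cg , lin , van , tl) =
      (λ q → trans (sym (e _)) (trans (cg q) (e _)))
    , (λ B → linear-resp (λ v → e (v ∷ B)) (lin B))
    , vanish m {f = f} {g} e van
    , (λ v → alt-resp m (λ B → e (v ∷ B)) (tl v))
    where
    vanish : ∀ m {n} {f g : Rows (suc m) n → Carrier} → (∀ A → f A ≈ g A) →
             HeadVanishing m f → HeadVanishing m g
    vanish zero    e p = tt
    vanish (suc m) e p = λ v B → trans (sym (e _)) (p v B)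

  alt-Σ : ∀ m {n} k (a : Fin k → Carrier) {f : Fin k → Rows m n → Carrier} →
          (∀ j → Alternating m (f j)) → Alternating m (λ A → Σ k (λ j → a j * f j A))
  alt-Σ zero    k a p = λ q → Σ-cong k (λ j → *-congˡ {x = a j} (p j q))
  alt-Σ (suc m) k a {f} p =
      (λ q → Σ-cong k (λ j → *-congˡ {x = a j} (proj₁ (p j) q)))
    , (λ B → linear-Σ k a (λ j → proj₁ (proj₂ (p j)) B))
    , vanish m f (λ j → proj₁ (proj₂ (proj₂ (p j))))
    , (λ v → alt-Σ m k a (λ j → proj₂ (proj₂ (proj₂ (p j))) v))
    where
    vanish : ∀ m {n} (f : Fin k → Rows (suc m) n → Carrier) → (∀ j → HeadVanishing m (f j)) →
             HeadVanishing m (λ A → Σ k (λ j → a j * f j A))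
    vanish zero    f p = tt
    vanish (suc m) f p = λ v B → Σ-zero k (λ j → trans (*-congˡ (p j v B)) (zeroʳ (a j)))

  -- Serves for deleting a column, inserting a zero coordinate and multiplying on the right by a
  -- matrix. Linearity of `L` is asked coordinate by coordinate, since rows are compared pointwise.
  alt-map : ∀ m {n k} {f : Rows m n → Carrier} (L : Row k → Row n) →
            (∀ j → IsLinear (λ v → L v j)) → Alternating m f → Alternating m (λ A → f (λ i → L (A i)))
  alt-map zero    L l p = λ q → p (λ ())
  alt-map (suc m) {f = f} L l (cg , lin , van , tl) =
      (λ q → cg (λ i j → cong (l j) (q i)))
    , (λ B → record
        { cong   = λ q → cg λ { zero j → cong (l j) q ; (suc i) j → refl }
        ; +-homo = λ u v → begin
            f (λ i → L (((λ k → u k + v k) ∷ B) i))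
              ≈⟨ cg (λ { zero j → +-homo (l j) u v ; (suc i) j → refl }) ⟩
            f ((λ j → L u j + L v j) ∷ (L ∘ B))
              ≈⟨ +-homo (lin (L ∘ B)) (L u) (L v) ⟩
            f (L u ∷ (L ∘ B)) + f (L v ∷ (L ∘ B))
              ≈⟨ +-cong (unfold u B) (unfold v B) ⟩
            f (λ i → L ((u ∷ B) i)) + f (λ i → L ((v ∷ B) i)) ∎
        ; *-homo = λ a v → begin
            f (λ i → L (((λ k → a * v k) ∷ B) i))
              ≈⟨ cg (λ { zero j → *-homo (l j) a v ; (suc i) j → refl }) ⟩
            f ((λ j → a * L v j) ∷ (L ∘ B))
              ≈⟨ *-homo (lin (L ∘ B)) a (L v) ⟩
            a * f (L v ∷ (L ∘ B))
              ≈⟨ *-congˡ (unfold v B) ⟩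
            a * f (λ i → L ((v ∷ B) i)) ∎
        })
    , vanish m cg van
    , (λ v → alt-resp m (unfold v) (alt-map m L l (tl (L v))))
    where
    -- The two families of rows agree only pointwise, so congruence of `f` has to identify them.
    unfold : ∀ v B → f (L v ∷ (L ∘ B)) ≈ f (λ i → L ((v ∷ B) i))
    unfold v B = cg λ { zero j → refl ; (suc i) j → refl }

    vanish : ∀ m {f : Rows (suc m) _ → Carrier} → Congruent f → HeadVanishing m f →
             HeadVanishing m (λ A → f (λ i → L (A i)))
    vanish zero    cg p = tt
    vanish (suc m) cg p = λ v B →
      trans (cg (λ { zero j → refl ; (suc zero) j → refl ; (suc (suc i)) j → refl }))
            (p (L v) (L ∘ B))

  -- The terms of the double expansion along two equal rows v cancel in pairs;
  -- D ρ stands for the minor on the columns picked by ρ.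
  double-expansion-vanishes :
    ∀ n (v : Row (suc (suc n))) (D : (Fin n → Fin (suc (suc n))) → Carrier) →
    (∀ {ρ σ} → (∀ b → ρ b ≡ σ b) → D ρ ≈ D σ) →
    Σ (suc (suc n)) (λ j → Σ (suc n) (λ k →
      (sgn (toℕ j) * sgn (toℕ k)) * ((v j * v (punchIn j k)) * D (λ b → punchIn j (punchIn k b)))))
      ≈ 0#
  double-expansion-vanishes n v D D-cong = begin
    -- The index pairs fall into (0, k), (k + 1, 0) and (j + 1, k + 1). The first two kinds choose
    -- the same two columns in opposite order, with opposite signs; the third kind is the same sum
    -- with column 0 set aside.
    Σ (suc n) (h zero) + Σ (suc n) (λ j → h (suc j) zero + Σ n (λ k → h (suc j) (suc k)))
      ≈⟨ +-congˡ (Σ-+ (suc n) (λ j → h (suc j) zero) (λ j → Σ n (λ k → h (suc j) (suc k)))) ⟩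
    Σ (suc n) (h zero) + (Σ (suc n) (λ j → h (suc j) zero)
      + Σ (suc n) (λ j → Σ n (λ k → h (suc j) (suc k))))
      ≈⟨ sym (+-assoc _ _ _) ⟩
    (Σ (suc n) (h zero) + Σ (suc n) (λ j → h (suc j) zero))
      + Σ (suc n) (λ j → Σ n (λ k → h (suc j) (suc k)))
      ≈⟨ +-cong (trans (sym (Σ-+ (suc n) (h zero) (λ j → h (suc j) zero))) (Σ-zero (suc n) cancel)) (inner n v D D-cong) ⟩
    0# + 0#
      ≈⟨ +-identityˡ 0# ⟩
    0# ∎
    where
    h : Fin (suc (suc n)) → Fin (suc n) → Carrier
    h j k = (sgn (toℕ j) * sgn (toℕ k)) * ((v j * v (punchIn j k)) * D (λ b → punchIn j (punchIn k b)))

    cancel : ∀ k → h zero k + h (suc k) zero ≈ 0#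
    cancel k = begin
      (1# * s) * ((v zero * v (suc k)) * d) + (sgn (suc (toℕ k)) * 1#) * ((v (suc k) * v zero) * d)
        ≈⟨ +-congˡ (*-congʳ (*-congʳ (sgn-suc (toℕ k)))) ⟩
      (1# * s) * ((v zero * v (suc k)) * d) + ((- s) * 1#) * ((v (suc k) * v zero) * d)
        ≈⟨ solve 5 (λ s t a b d → (con 1 :* s) :* ((a :* b) :* d) :+ (t :* con 1) :* ((b :* a) :* d)
                                  := (s :+ t) :* ((a :* b) :* d)) refl _ _ _ _ _ ⟩
      (s + - s) * ((v zero * v (suc k)) * d)
        ≈⟨ trans (*-congʳ (-‿inverseʳ s)) (zeroˡ _) ⟩
      0# ∎
      where
      s d : Carrier
      s = sgn (toℕ k)
      d = D (λ b → suc (punchIn k b))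

    inner : ∀ n (v : Row (suc (suc n))) (D : (Fin n → Fin (suc (suc n))) → Carrier) →
      (∀ {ρ σ} → (∀ b → ρ b ≡ σ b) → D ρ ≈ D σ) →
      Σ (suc n) (λ j → Σ n (λ k → (sgn (suc (toℕ j)) * sgn (suc (toℕ k)))
        * ((v (suc j) * v (suc (punchIn j k))) * D (λ b → punchIn (suc j) (punchIn (suc k) b)))))
        ≈ 0#
    inner zero    v D D-cong = trans (+-identityˡ 0#) refl
    inner (suc n) v D D-cong = trans
      (Σ-cong (suc (suc n)) (λ j → Σ-cong (suc n) (λ k → term j k)))
      (double-expansion-vanishes n (v ∘ suc) D′
        (λ p → D-cong λ { zero → ≡.refl ; (suc b) → ≡.cong suc (p b) }))
      where
      -- When both deleted columns are nonzero, column 0 survives as the first column of the minor.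
      D′ : (Fin n → Fin (suc (suc n))) → Carrier
      D′ ρ = D (zero ∷ (suc ∘ ρ))
      neg² : ∀ a b → (- a) * (- b) ≈ a * b
      neg² a b = trans (sym (-‿distribˡ-* a (- b)))
        (trans (-‿cong (sym (-‿distribʳ-* a b))) (-‿involutive (a * b)))
      term : ∀ j k →
        (sgn (suc (toℕ j)) * sgn (suc (toℕ k)))
          * ((v (suc j) * v (suc (punchIn j k))) * D (λ b → punchIn (suc j) (punchIn (suc k) b)))
        ≈ (sgn (toℕ j) * sgn (toℕ k))
          * ((v (suc j) * v (suc (punchIn j k))) * D′ (λ b → punchIn j (punchIn k b)))
      term j k = *-cong
        (trans (*-cong (sgn-suc (toℕ j)) (sgn-suc (toℕ k))) (neg² _ _))
        (*-congˡ (D-cong λ { zero → ≡.refl ; (suc b) → ≡.refl }))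

  -- The expansion is visibly linear in the first row. With that row fixed it is a linear
  -- combination of minors, and each minor is a smaller determinant after the linear map that
  -- deletes a column, so induction applies.
  det-alternating : ∀ n → Alternating n (det {n})
  det-alternating zero    = λ _ → refl
  det-alternating (suc n) =
      det-cong
    , (λ B → linear-Σ (suc n) (sgn ∘ toℕ) (λ j → linear-coord j (minor B j)))
    , vanish n
    , (λ v → alt-resp n (λ B → Σ-cong (suc n) (λ j → *-assoc (sgn (toℕ j)) (v j) (minor B j)))
        (alt-Σ n (suc n) (λ j → sgn (toℕ j) * v j)
          (λ j → alt-map n (λ w b → w (punchIn j b))
            (λ b → coord (punchIn j b))
            (det-alternating n))))
    where
    minor : ∀ {n} → Rows n (suc n) → Fin (suc n) → Carrier
    minor B j = det (λ a b → B a (punchIn j b))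

    coord : ∀ {n} (j : Fin n) → IsLinear (λ v → v j)
    coord j = linear-resp (λ v → *-identityʳ (v j)) (linear-coord j 1#)

    vanish : ∀ n → HeadVanishing n det
    vanish zero    = tt
    vanish (suc n) v B = trans
      (Σ-cong (suc (suc n)) (λ j → begin
        sgn (toℕ j) * (v j * Σ (suc n) (λ k → sgn (toℕ k) * (v (punchIn j k) * d j k)))
          ≈⟨ sym (*-assoc (sgn (toℕ j)) (v j) _) ⟩
        (sgn (toℕ j) * v j) * Σ (suc n) (λ k → sgn (toℕ k) * (v (punchIn j k) * d j k))
          ≈⟨ *-Σ (suc n) (sgn (toℕ j) * v j) (λ k → sgn (toℕ k) * (v (punchIn j k) * d j k)) ⟩
        Σ (suc n) (λ k → (sgn (toℕ j) * v j) * (sgn (toℕ k) * (v (punchIn j k) * d j k)))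
          ≈⟨ Σ-cong (suc n) (λ k → solve 5 (λ s a t b e →
               (s :* a) :* (t :* (b :* e)) := (s :* t) :* ((a :* b) :* e)) refl
               (sgn (toℕ j)) (v j) (sgn (toℕ k)) (v (punchIn j k)) (d j k)) ⟩
        Σ (suc n) (λ k → (sgn (toℕ j) * sgn (toℕ k)) * ((v j * v (punchIn j k)) * d j k)) ∎))
      (double-expansion-vanishes n v (λ ρ → det (λ a b → B a (ρ b)))
        (λ p → det-cong (λ a b → reflexive (≡.cong (B a) (p b)))))
      where
      d : Fin (suc (suc n)) → Fin (suc n) → Carrier
      d j k = det (λ a b → B a (punchIn j (punchIn k b)))

  -- Polarisation: the value on the rows u + w, u + w is zero and is expanded in both of them.
  alt-swap : ∀ m {n} {f : Rows (suc (suc m)) n → Carrier} → Alternating (suc (suc m)) f →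
             ∀ u w B → f (u ∷ w ∷ B) ≈ - f (w ∷ u ∷ B)
  alt-swap m {f = f} (cg , lin , van , tl) u w B = +-inverseˡ-unique _ _ (begin
    f (u ∷ w ∷ B) + f (w ∷ u ∷ B)
      ≈⟨ +-cong (sym (trans (+-congʳ (van u B)) (+-identityˡ _)))
                (sym (trans (+-congˡ (van w B)) (+-identityʳ _))) ⟩
    (f (u ∷ u ∷ B) + f (u ∷ w ∷ B)) + (f (w ∷ u ∷ B) + f (w ∷ w ∷ B))
      ≈⟨ sym (+-cong (second u) (second w)) ⟩
    f (u ∷ u+w ∷ B) + f (w ∷ u+w ∷ B)
      ≈⟨ sym (+-homo (lin (u+w ∷ B)) u w) ⟩
    f (u+w ∷ u+w ∷ B)
      ≈⟨ van u+w B ⟩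
    0# ∎)
    where
    u+w : Row _
    u+w i = u i + w i
    second : ∀ v → f (v ∷ u+w ∷ B) ≈ f (v ∷ u ∷ B) + f (v ∷ w ∷ B)
    second v = +-homo (proj₁ (proj₂ (tl v)) B) u w

  -- Vanishing is known only for adjacent equal rows. So the row below `v` is cleared, `v` is
  -- swapped past it, induction treats the rows further down, and `v` is swapped back.
  alt-shear : ∀ m {n} {f : Rows (suc m) n → Carrier} → Alternating (suc m) f →
              ∀ v B (a : Fin m → Carrier) → f (v ∷ (λ k i → B k i + a k * v i)) ≈ f (v ∷ B)
  alt-shear zero    p v B a = proj₁ p λ { zero j → refl ; (suc ()) j }
  alt-shear (suc m) {f = f} p@(cg , lin , van , tl) v B a = begin
    f (v ∷ (λ k i → B k i + a k * v i))
      ≈⟨ cg (λ { zero j → refl ; (suc zero) j → refl ; (suc (suc i)) j → refl }) ⟩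
    f (v ∷ (λ i → B zero i + a zero * v i) ∷ T)
      ≈⟨ +*-homo (proj₁ (proj₂ (tl v)) T) (B zero) (a zero) v ⟩
    f (v ∷ B zero ∷ T) + a zero * f (v ∷ v ∷ T)
      ≈⟨ trans (+-congˡ (trans (*-congˡ (van v T)) (zeroʳ _))) (+-identityʳ _) ⟩
    f (v ∷ B zero ∷ T)
      ≈⟨ alt-swap m p v (B zero) T ⟩
    - f (B zero ∷ v ∷ T)
      ≈⟨ -‿cong (alt-shear m (tl (B zero)) v (B ∘ suc) (a ∘ suc)) ⟩
    - f (B zero ∷ v ∷ (B ∘ suc))
      ≈⟨ sym (alt-swap m p v (B zero) (B ∘ suc)) ⟩
    f (v ∷ B zero ∷ (B ∘ suc))
      ≈⟨ cg (λ { zero j → refl ; (suc zero) j → refl ; (suc (suc i)) j → refl }) ⟩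
    f (v ∷ B) ∎
    where
    T : Rows m _
    T k i = B (suc k) i + a (suc k) * v i

  insertAt-linear : ∀ {n} (j : Fin (suc n)) l → IsLinear (λ w → insertAt w j 0# l)
  insertAt-linear j l with j ≟ l
  ... | yes ≡.refl = linear-resp (λ w → trans (zeroʳ 0#) (reflexive (≡.sym (insertAt-lookup w j 0#)))) zeroLinear
    where
    zeroLinear : IsLinear (λ w → 0# * 0#)
    zeroLinear = record
      { cong   = λ _ → refl
      ; +-homo = λ _ _ → trans (zeroʳ 0#) (sym (trans (+-cong (zeroʳ 0#) (zeroʳ 0#)) (+-identityʳ 0#)))
      ; *-homo = λ a _ → trans (zeroʳ 0#) (sym (trans (*-congˡ (zeroʳ 0#)) (zeroʳ a)))
      }
  ... | no j≢l = ≡.subst (λ l → IsLinear (λ w → insertAt w j 0# l)) (punchIn-punchOut j≢l)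
    (linear-resp (λ w → trans (*-identityʳ _) (reflexive (≡.sym (insertAt-punchIn w j 0# (punchOut j≢l)))))
      (linear-coord (punchOut j≢l) 1#))

  -- Row j is moved to the front of `I`, a cycle with sign (-1)^j. One swap restores row 0; with it
  -- fixed, the other rows of `I` are those of a smaller identity padded by a zero, and induction
  -- applies to the form `g`.
  alt-cycle : ∀ n {f : Rows (suc n) (suc n) → Carrier} → Alternating (suc n) f →
              ∀ j → f (I j ∷ (λ k → I (punchIn j k))) ≈ sgn (toℕ j) * f I
  alt-cycle n p zero = trans
    (proj₁ p λ { zero j → refl ; (suc i) j → refl }) (sym (*-identityˡ _))
  alt-cycle (suc n) {f} p@(cg , lin , van , tl) (suc j) = begin
    f (I (suc j) ∷ (λ k → I (punchIn (suc j) k)))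
      ≈⟨ cg (λ { zero i → refl ; (suc zero) i → refl ; (suc (suc _)) i → refl }) ⟩
    f (I (suc j) ∷ I zero ∷ (λ k → I (suc (punchIn j k))))
      ≈⟨ alt-swap n p _ _ _ ⟩
    - f (I zero ∷ I (suc j) ∷ (λ k → I (suc (punchIn j k))))
      ≈⟨ -‿cong (cg λ { zero i → refl
                      ; (suc zero) zero → refl
                      ; (suc zero) (suc i) → refl
                      ; (suc (suc k)) zero → refl
                      ; (suc (suc k)) (suc i) → refl }) ⟩
    - g (I j ∷ (λ k → I (punchIn j k)))
      ≈⟨ -‿cong (alt-cycle n (alt-map (suc n) pad pad-linear (tl (I zero))) j) ⟩
    - (sgn (toℕ j) * g I)
      ≈⟨ -‿distribˡ-* _ _ ⟩
    (- sgn (toℕ j)) * g I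
      ≈⟨ *-cong (sym (sgn-suc (toℕ j)))
           (cg λ { zero i → refl ; (suc k) zero → refl ; (suc k) (suc i) → refl }) ⟩
    sgn (suc (toℕ j)) * f I ∎
    where
    pad : Row (suc n) → Row (suc (suc n))
    pad w = insertAt w zero 0#
    pad-linear : ∀ l → IsLinear (λ w → pad w l)
    pad-linear = insertAt-linear zero
    g : Rows (suc n) (suc n) → Carrier
    g B = f (I zero ∷ (λ i → pad (B i)))

  I-diag : ∀ {n} (i : Fin n) → I i i ≈ 1#
  I-diag i = reflexive (≡.cong ⟦_⟧ (dec-true (i ≟ i) ≡.refl))

  I-off : ∀ {n} {i j : Fin n} → i ≢ j → I i j ≈ 0#
  I-off {i = i} {j} i≢j = reflexive (≡.cong ⟦_⟧ (dec-false (i ≟ j) i≢j))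

  I-injective : ∀ {m n} (h : Fin m → Fin n) → (∀ i j → h i ≡ h j → i ≡ j) →
                ∀ i j → I (h i) (h j) ≈ I i j
  I-injective h inj i j = reflexive (≡.cong ⟦_⟧
    (does-⇔ (mk⇔ (inj i j) (≡.cong h)) (h i ≟ h j) (i ≟ j)))

  -- Uniqueness of the determinant. The first row is expanded into unit vectors `I j`; a shear by
  -- `I j` then clears column j in the other rows, so what remains is an alternating function of the
  -- minor, padded by a zero at j. Induction extracts the minor, and `alt-cycle` supplies the sign.
  alt≈det : ∀ n {f : Rows n n → Carrier} → Alternating n f → ∀ A → f A ≈ det A * f I
  alt≈det zero    p A = trans (p (λ ())) (sym (*-identityˡ _))
  alt≈det (suc n) {f} p@(cg , lin , van , tl) A = begin
    f A
      ≈⟨ cg (λ { zero l → sym (Σ-Iʳ (suc n) l (A zero)) ; (suc i) l → refl }) ⟩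
    f ((λ l → Σ (suc n) (λ j → A zero j * I j l)) ∷ (A ∘ suc))
      ≈⟨ Σ-homo (lin (A ∘ suc)) (suc n) (A zero) I ⟩
    Σ (suc n) (λ j → A zero j * f (I j ∷ (A ∘ suc)))
      ≈⟨ Σ-cong (suc n) (λ j → *-congˡ {x = A zero j} (expand j)) ⟩
    Σ (suc n) (λ j → A zero j * (minor j * (sgn (toℕ j) * f I)))
      ≈⟨ Σ-cong (suc n) (λ j → solve 4 (λ a d s e →
           a :* (d :* (s :* e)) := (s :* (a :* d)) :* e) refl
           (A zero j) (minor j) (sgn (toℕ j)) (f I)) ⟩
    Σ (suc n) (λ j → (sgn (toℕ j) * (A zero j * minor j)) * f I)
      ≈⟨ sym (Σ-* (suc n) (λ j → sgn (toℕ j) * (A zero j * minor j)) (f I)) ⟩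
    det A * f I ∎
    where
    minor : Fin (suc n) → Carrier
    minor j = det (λ a b → A (suc a) (punchIn j b))

    ins : Fin (suc n) → Row n → Row (suc n)
    ins j w = insertAt w j 0#

    clear : ∀ j k l → A (suc k) l ≈ ins j (λ b → A (suc k) (punchIn j b)) l + A (suc k) j * I j l
    clear j k l with j ≟ l
    ... | yes ≡.refl = sym (begin
      ins j (λ b → A (suc k) (punchIn j b)) j + A (suc k) j * 1#
        ≈⟨ +-cong (reflexive (insertAt-lookup _ j 0#)) (*-identityʳ _) ⟩
      0# + A (suc k) j
        ≈⟨ +-identityˡ _ ⟩
      A (suc k) j ∎)
    ... | no j≢l = sym (begin
      ins j row l + A (suc k) j * 0#
        ≈⟨ trans (+-congˡ (zeroʳ _)) (+-identityʳ _) ⟩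
      ins j row l
        ≈⟨ reflexive (≡.cong (ins j row) (≡.sym (punchIn-punchOut j≢l))) ⟩
      ins j row (punchIn j (punchOut j≢l))
        ≈⟨ reflexive (insertAt-punchIn row j 0# (punchOut j≢l)) ⟩
      A (suc k) (punchIn j (punchOut j≢l))
        ≈⟨ reflexive (≡.cong (A (suc k)) (punchIn-punchOut j≢l)) ⟩
      A (suc k) l ∎)
      where
      row : Row n
      row b = A (suc k) (punchIn j b)

    ins-I : ∀ j k l → ins j (I k) l ≈ I (punchIn j k) l
    ins-I j k l with j ≟ l
    ... | yes ≡.refl = trans (reflexive (insertAt-lookup (I k) j 0#)) (sym (I-off (punchInᵢ≢i j k)))
    ... | no j≢l = ≡.subst (λ l → ins j (I k) l ≈ I (punchIn j k) l) (punchIn-punchOut j≢l)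
      (trans (reflexive (insertAt-punchIn (I k) j 0# (punchOut j≢l)))
             (sym (I-injective (punchIn j) (punchIn-injective j) k (punchOut j≢l))))

    expand : ∀ j → f (I j ∷ (A ∘ suc)) ≈ minor j * (sgn (toℕ j) * f I)
    expand j = begin
      f (I j ∷ (A ∘ suc))
        ≈⟨ cg (λ { zero l → refl ; (suc k) l → clear j k l }) ⟩
      f (I j ∷ (λ k l → ins j (λ b → A (suc k) (punchIn j b)) l + A (suc k) j * I j l))
        ≈⟨ alt-shear n p (I j) (λ k → ins j (λ b → A (suc k) (punchIn j b))) (λ k → A (suc k) j) ⟩
      f (I j ∷ (λ k → ins j (λ b → A (suc k) (punchIn j b))))
        ≈⟨ alt≈det n (alt-map n (ins j) (insertAt-linear j) (tl (I j))) (λ a b → A (suc a) (punchIn j b)) ⟩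
      minor j * f (I j ∷ (λ k → ins j (I k)))
        ≈⟨ *-congˡ (cg λ { zero l → refl ; (suc k) l → ins-I j k l }) ⟩
      minor j * f (I j ∷ (λ k → I (punchIn j k)))
        ≈⟨ *-congˡ (alt-cycle n p j) ⟩
      minor j * (sgn (toℕ j) * f I) ∎

  -- As a function of the rows of `M` the left side is alternating, because each row undergoes the
  -- linear map v ↦ vN; its value at `I` is det N.
  det-· : ∀ {n} (M N : Mat n) → det (M · N) ≈ det M * det N
  det-· {n} M N = trans
    (alt≈det n (alt-map n (λ v j → Σ n (λ k → v k * N k j))
      (λ j → linear-resp (λ v → Σ-cong n (λ k → *-comm _ _))
        (linear-Σ n (λ k → N k j) (λ k → linear-resp (λ v → *-identityʳ (v k)) (linear-coord k 1#))))
      (det-alternating n)) M)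
    (*-congˡ (det-cong (λ i j → Σ-Iˡ n i (λ k → N k j))))

  -- Block matrices

  ↑-elim : ∀ {p} n m (P : Fin (n +ℕ m) → Set p) →
           (∀ i → P (i ↑ˡ m)) → (∀ j → P (n ↑ʳ j)) → ∀ k → P k
  ↑-elim n m P l r k with splitAt n k in eq
  ... | inj₁ i = ≡.subst P (splitAt⁻¹-↑ˡ eq) (l i)
  ... | inj₂ j = ≡.subst P (splitAt⁻¹-↑ʳ eq) (r j)

  combine-elim : ∀ {p} n m (P : Fin (n *ℕ m) → Set p) →
                 (∀ i j → P (combine i j)) → ∀ k → P k
  combine-elim n m P h k =
    ≡.subst P (combine-remQuot {n} m k) (h (proj₁ (remQuot {n} m k)) (proj₂ (remQuot {n} m k)))

  -- Expansion runs along a row, so a statement on a column needs induction: deleting any other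
  -- column leaves the zero column first in the minor.
  det-zero-column : ∀ n (M : Mat (suc n)) → (∀ i → M i zero ≈ 0#) → det M ≈ 0#
  det-zero-column n M p = Σ-zero (suc n) (term n M p)
    where
    term : ∀ n (M : Mat (suc n)) → (∀ i → M i zero ≈ 0#) → ∀ j →
           sgn (toℕ j) * (M zero j * det (λ a b → M (suc a) (punchIn j b))) ≈ 0#
    term n       M p zero    = trans (*-congˡ (trans (*-congʳ (p zero)) (zeroˡ _))) (zeroʳ _)
    term (suc n) M p (suc j) = trans
      (*-congˡ (trans (*-congˡ (det-zero-column n (λ a b → M (suc a) (punchIn (suc j) b)) (p ∘ suc))) (zeroʳ _)))
      (zeroʳ _)

  det-unit-column : ∀ n (M : Mat (suc n)) → M zero zero ≈ 1# → (∀ i → M (suc i) zero ≈ 0#) →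
                    det M ≈ det (λ a b → M (suc a) (suc b))
  det-unit-column n M p q = trans
    (+-cong (trans (*-identityˡ _) (trans (*-congʳ p) (*-identityˡ _))) (Σ-zero n (term n M q)))
    (+-identityʳ _)
    where
    term : ∀ n (M : Mat (suc n)) → (∀ i → M (suc i) zero ≈ 0#) → ∀ j →
           sgn (suc (toℕ j)) * (M zero (suc j) * det (λ a b → M (suc a) (punchIn (suc j) b))) ≈ 0#
    term (suc n) M q j = trans
      (*-congˡ (trans (*-congˡ (det-zero-column n (λ a b → M (suc a) (punchIn (suc j) b)) q)) (zeroʳ _)))
      (zeroʳ _)

  det-I : ∀ n → det (I {n}) ≈ 1#
  det-I zero    = refl
  det-I (suc n) = trans (det-unit-column n I refl (λ _ → refl)) (det-I n)

  punchIn-↑ˡ-↑ˡ : ∀ {n} m (j : Fin (suc n)) (b : Fin n) → punchIn (j ↑ˡ m) (b ↑ˡ m) ≡ punchIn j b ↑ˡ m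
  punchIn-↑ˡ-↑ˡ m zero    b       = ≡.refl
  punchIn-↑ˡ-↑ˡ m (suc j) zero    = ≡.refl
  punchIn-↑ˡ-↑ˡ m (suc j) (suc b) = ≡.cong suc (punchIn-↑ˡ-↑ˡ m j b)

  punchIn-↑ˡ-↑ʳ : ∀ {n m} (j : Fin (suc n)) (b : Fin m) → punchIn (j ↑ˡ m) (n ↑ʳ b) ≡ suc n ↑ʳ b
  punchIn-↑ˡ-↑ʳ         zero    b = ≡.refl
  punchIn-↑ˡ-↑ʳ {suc n} (suc j) b = ≡.cong suc (punchIn-↑ˡ-↑ʳ j b)


  -- The first row meets nonzero entries only in the left block, and deleting one of those columns
  -- leaves the lower right block intact, so its determinant is a common factor.
  det-block-lower : ∀ n m (M : Mat (n +ℕ m)) → (∀ i j → M (i ↑ˡ m) (n ↑ʳ j) ≈ 0#) →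
    det M ≈ det (λ a b → M (a ↑ˡ m) (b ↑ˡ m)) * det (λ a b → M (n ↑ʳ a) (n ↑ʳ b))
  det-block-lower zero    m M p = sym (*-identityˡ _)
  det-block-lower (suc n) m M p = begin
    det M
      ≈⟨ Σ-split (suc n) m term ⟩
    Σ (suc n) (λ j → term (j ↑ˡ m)) + Σ m (λ j → term (suc n ↑ʳ j))
      ≈⟨ +-cong (Σ-cong (suc n) {λ j → term (j ↑ˡ m)} {λ j → topTerm j * D} left)
                (Σ-zero m (λ j → trans (*-congˡ (trans (*-congʳ (p zero j)) (zeroˡ _))) (zeroʳ _))) ⟩
    Σ (suc n) (λ j → topTerm j * D) + 0#
      ≈⟨ +-identityʳ _ ⟩
    Σ (suc n) (λ j → topTerm j * D)
      ≈⟨ sym (Σ-* (suc n) topTerm D) ⟩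
    det (λ a b → M (a ↑ˡ m) (b ↑ˡ m)) * D ∎
    where
    D : Carrier
    D = det (λ a b → M (suc n ↑ʳ a) (suc n ↑ʳ b))
    term : Fin (suc n +ℕ m) → Carrier
    term j = sgn (toℕ j) * (M zero j * det (λ a b → M (suc a) (punchIn j b)))
    minor : Fin (suc n) → Carrier
    minor j = det (λ a b → M (suc (a ↑ˡ m)) (punchIn j b ↑ˡ m))
    topTerm : Fin (suc n) → Carrier
    topTerm j = sgn (toℕ j) * (M zero (j ↑ˡ m) * minor j)
    left : ∀ j → term (j ↑ˡ m) ≈ topTerm j * D
    left j = begin
      sgn (toℕ (j ↑ˡ m)) * (M zero (j ↑ˡ m) * det (λ a b → M (suc a) (punchIn (j ↑ˡ m) b)))
        ≈⟨ *-cong (reflexive (≡.cong sgn (toℕ-↑ˡ j m))) (*-congˡ (begin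
          det (λ a b → M (suc a) (punchIn (j ↑ˡ m) b))
            ≈⟨ det-block-lower n m (λ a b → M (suc a) (punchIn (j ↑ˡ m) b)) (λ i k →
                 trans (reflexive (≡.cong (M (suc (i ↑ˡ m))) (punchIn-↑ˡ-↑ʳ j k))) (p (suc i) k)) ⟩
          det (λ a b → M (suc (a ↑ˡ m)) (punchIn (j ↑ˡ m) (b ↑ˡ m)))
            * det (λ a b → M (suc (n ↑ʳ a)) (punchIn (j ↑ˡ m) (n ↑ʳ b)))
            ≈⟨ *-cong (det-cong (λ a b → reflexive (≡.cong (M (suc (a ↑ˡ m))) (punchIn-↑ˡ-↑ˡ m j b))))
                      (det-cong (λ a b → reflexive (≡.cong (M (suc (n ↑ʳ a))) (punchIn-↑ˡ-↑ʳ j b)))) ⟩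
          minor j * D ∎)) ⟩
      sgn (toℕ j) * (M zero (j ↑ˡ m) * (minor j * D))
        ≈⟨ solve 4 (λ s a e d → s :* (a :* (e :* d)) := (s :* (a :* e)) :* d) refl
             (sgn (toℕ j)) (M zero (j ↑ˡ m)) (minor j) D ⟩
      topTerm j * D ∎

  -- The upper right block is arbitrary here, so the reduction goes through the first column, which
  -- is a unit vector.
  det-unitriangular : ∀ n m (U : Mat (n +ℕ m)) →
    (∀ a b → U (a ↑ˡ m) (b ↑ˡ m) ≈ I a b) → (∀ a b → U (n ↑ʳ a) (b ↑ˡ m) ≈ 0#) →
    (∀ a b → U (n ↑ʳ a) (n ↑ʳ b) ≈ I a b) → det U ≈ 1#
  det-unitriangular zero    m U p q r = trans (det-cong r) (det-I m)
  det-unitriangular (suc n) m U p q r = trans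
    (det-unit-column (n +ℕ m) U (p zero zero)
      (↑-elim n m (λ i → U (suc i) zero ≈ 0#) (λ i → p (suc i) zero) (λ j → q j zero)))
    (det-unitriangular n m (λ a b → U (suc a) (suc b))
      (λ a b → p (suc a) (suc b)) (λ a b → q a (suc b)) r)

  -- Left multiplication by the block matrix (I X ; 0 I) clears the upper right block.
  det-schur : ∀ n m (M : Mat (n +ℕ m)) (X : Fin n → Fin m → Carrier) →
    (∀ a k → M (a ↑ˡ m) (n ↑ʳ k) + Σ m (λ l → X a l * M (n ↑ʳ l) (n ↑ʳ k)) ≈ 0#) →
    det M ≈ det (λ a b → M (a ↑ˡ m) (b ↑ˡ m) + Σ m (λ l → X a l * M (n ↑ʳ l) (b ↑ˡ m)))
            * det (λ a b → M (n ↑ʳ a) (n ↑ʳ b))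
  det-schur n m M X p = begin
    det M
      ≈⟨ sym (*-identityˡ _) ⟩
    1# * det M
      ≈⟨ *-congʳ (sym (det-unitriangular n m U
           (λ a b → trans (U-top a (b ↑ˡ m)) (reflexive (≡.cong [ I a , X a ]′ (splitAt-↑ˡ n b m))))
           (λ a b → trans (U-bottom a (b ↑ˡ m)) (reflexive (≡.cong [ (λ _ → 0#) , I a ]′ (splitAt-↑ˡ n b m))))
           (λ a b → trans (U-bottom a (n ↑ʳ b)) (reflexive (≡.cong [ (λ _ → 0#) , I a ]′ (splitAt-↑ʳ n m b)))))) ⟩
    det U * det M
      ≈⟨ sym (det-· U M) ⟩
    det (U · M)
      ≈⟨ det-block-lower n m (U · M) (λ i j → trans (UM-top i (n ↑ʳ j)) (p i j)) ⟩
    det (λ a b → (U · M) (a ↑ˡ m) (b ↑ˡ m)) * det (λ a b → (U · M) (n ↑ʳ a) (n ↑ʳ b))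
      ≈⟨ *-cong (det-cong (λ a b → UM-top a (b ↑ˡ m))) (det-cong (λ a b → UM-bottom a (n ↑ʳ b))) ⟩
    det (λ a b → M (a ↑ˡ m) (b ↑ˡ m) + Σ m (λ l → X a l * M (n ↑ʳ l) (b ↑ˡ m)))
      * det (λ a b → M (n ↑ʳ a) (n ↑ʳ b)) ∎
    where
    U : Mat (n +ℕ m)
    U i k = [ (λ a → [ I a , X a ]′ (splitAt n k))
            , (λ a → [ (λ _ → 0#) , I a ]′ (splitAt n k)) ]′ (splitAt n i)

    U-top : ∀ a k → U (a ↑ˡ m) k ≈ [ I a , X a ]′ (splitAt n k)
    U-top a k rewrite splitAt-↑ˡ n a m = refl

    U-bottom : ∀ a k → U (n ↑ʳ a) k ≈ [ (λ _ → 0#) , I a ]′ (splitAt n k)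
    U-bottom a k rewrite splitAt-↑ʳ n m a = refl

    UM-top : ∀ a k → (U · M) (a ↑ˡ m) k ≈ M (a ↑ˡ m) k + Σ m (λ l → X a l * M (n ↑ʳ l) k)
    UM-top a k = trans (Σ-split n m _) (+-cong
      (trans (Σ-cong n (λ b → *-congʳ (trans (U-top a (b ↑ˡ m))
        (reflexive (≡.cong [ I a , X a ]′ (splitAt-↑ˡ n b m)))))) (Σ-Iˡ n a (λ b → M (b ↑ˡ m) k)))
      (Σ-cong m (λ b → *-congʳ (trans (U-top a (n ↑ʳ b))
        (reflexive (≡.cong [ I a , X a ]′ (splitAt-↑ʳ n m b)))))))

    UM-bottom : ∀ a k → (U · M) (n ↑ʳ a) k ≈ M (n ↑ʳ a) k
    UM-bottom a k = trans (Σ-split n m _) (trans (+-cong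
      (Σ-zero n (λ b → trans (*-congʳ (trans (U-bottom a (b ↑ˡ m))
        (reflexive (≡.cong [ (λ _ → 0#) , I a ]′ (splitAt-↑ˡ n b m))))) (zeroˡ _)))
      (trans (Σ-cong m (λ b → *-congʳ (trans (U-bottom a (n ↑ʳ b))
        (reflexive (≡.cong [ (λ _ → 0#) , I a ]′ (splitAt-↑ʳ n m b)))))) (Σ-Iˡ m a (λ b → M (n ↑ʳ b) k))))
      (+-identityˡ _))

  det-block-diagonal : ∀ n {k} (M : Mat (n *ℕ k)) (C : Mat k) →
    (∀ (i : Fin n) j (i′ : Fin n) j′ → M (combine i j) (combine i′ j′) ≈ I i i′ * C j j′) → det M ≈ det C ^ n
  det-block-diagonal zero        M C p = refl
  det-block-diagonal (suc n) {k} M C p = trans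
    (det-block-lower k (n *ℕ k) M (λ j → combine-elim n k (λ l → M (j ↑ˡ (n *ℕ k)) (k ↑ʳ l) ≈ 0#)
      (λ i′ j′ → trans (p zero j (suc i′) j′) (zeroˡ _))))
    (*-cong (det-cong (λ a b → trans (p zero a zero b) (*-identityˡ _)))
      (det-block-diagonal n (λ a b → M (k ↑ʳ a) (k ↑ʳ b)) C
        (λ i j i′ j′ → p (suc i) j (suc i′) j′)))

  -- Polynomial functions

  -- Horner evaluation, constant coefficient first. Lists are not normalised: whether a top
  -- coefficient vanishes cannot be decided, and the length only bounds the degree.
  eval : List Carrier → Carrier → Carrier
  eval []       x = 0#
  eval (a ∷ₗ as) x = a + x * eval as x

  IsPolynomial : (Carrier → Carrier) → Set (c ⊔ ℓ)
  IsPolynomial f = ∃ λ as → ∀ x → f x ≈ eval as x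

  poly-resp : ∀ {f g} → (∀ x → g x ≈ f x) → IsPolynomial f → IsPolynomial g
  poly-resp e (as , p) = as , λ x → trans (e x) (p x)

  poly-const : ∀ a → IsPolynomial (λ _ → a)
  poly-const a = a ∷ₗ [] , λ x → sym (trans (+-congˡ (zeroʳ x)) (+-identityʳ a))

  poly-id : IsPolynomial (λ x → x)
  poly-id = 0# ∷ₗ 1# ∷ₗ [] , λ x → sym (trans (+-identityˡ _)
    (trans (*-congˡ (trans (+-congˡ (zeroʳ x)) (+-identityʳ 1#))) (*-identityʳ x)))

  poly-+ : ∀ {f g} → IsPolynomial f → IsPolynomial g → IsPolynomial (λ x → f x + g x)
  poly-+ (as , p) (bs , q) = add as bs , λ x → trans (+-cong (p x) (q x)) (eval-add as bs x)
    where
    add : List Carrier → List Carrier → List Carrier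
    add []        bs        = bs
    add as        []        = as
    add (a ∷ₗ as) (b ∷ₗ bs) = (a + b) ∷ₗ add as bs
    eval-add : ∀ as bs x → eval as x + eval bs x ≈ eval (add as bs) x
    eval-add []        bs        x = +-identityˡ _
    eval-add (a ∷ₗ as) []        x = +-identityʳ _
    eval-add (a ∷ₗ as) (b ∷ₗ bs) x = trans
      (solve 5 (λ a b x s t → (a :+ x :* s) :+ (b :+ x :* t) := (a :+ b) :+ x :* (s :+ t)) refl _ _ _ _ _)
      (+-congˡ (*-congˡ (eval-add as bs x)))

  poly-shift : ∀ {f} → IsPolynomial f → IsPolynomial (λ x → x * f x)
  poly-shift (as , p) = 0# ∷ₗ as , λ x → trans (*-congˡ (p x)) (sym (+-identityˡ _))

  poly-scale : ∀ a {f} → IsPolynomial f → IsPolynomial (λ x → a * f x)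
  poly-scale a (as , p) = map (a *_) as , λ x → trans (*-congˡ (p x)) (eval-map as x)
    where
    eval-map : ∀ as x → a * eval as x ≈ eval (map (a *_) as) x
    eval-map []        x = zeroʳ a
    eval-map (b ∷ₗ as) x = trans
      (solve 4 (λ a b x s → a :* (b :+ x :* s) := a :* b :+ x :* (a :* s)) refl _ _ _ _)
      (+-congˡ (*-congˡ (eval-map as x)))

  poly-− : ∀ {f g} → IsPolynomial f → IsPolynomial g → IsPolynomial (λ x → f x − g x)
  poly-− {g = g} p q = poly-+ p (poly-resp (λ x → sym (-1*x≈-x (g x))) (poly-scale (- 1#) q))

  poly-* : ∀ {f g} → IsPolynomial f → IsPolynomial g → IsPolynomial (λ x → f x * g x)
  poly-* {g = g} (as , p) q = poly-resp (λ x → *-congʳ (p x)) (go as)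
    where
    go : ∀ as → IsPolynomial (λ x → eval as x * g x)
    go []        = poly-resp (λ x → zeroˡ (g x)) (poly-const 0#)
    go (a ∷ₗ as) = poly-resp
      (λ x → trans (distribʳ (g x) a _) (+-congˡ (*-assoc x _ (g x))))
      (poly-+ (poly-scale a q) (poly-shift (go as)))

  poly-^ : ∀ {f} n → IsPolynomial f → IsPolynomial (λ x → f x ^ n)
  poly-^ zero    p = poly-const 1#
  poly-^ (suc n) p = poly-* p (poly-^ n p)

  poly-∘ : ∀ as {f} → IsPolynomial f → IsPolynomial (λ x → eval as (f x))
  poly-∘ []        p = poly-const 0#
  poly-∘ (a ∷ₗ as) p = poly-+ (poly-const a) (poly-* p (poly-∘ as p))

  poly-Σ : ∀ n {f : Fin n → Carrier → Carrier} → (∀ i → IsPolynomial (f i)) →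
           IsPolynomial (λ x → Σ n (λ i → f i x))
  poly-Σ zero    p = poly-const 0#
  poly-Σ (suc n) p = poly-+ (p zero) (poly-Σ n (p ∘ suc))

  poly-Π : ∀ n {f : Fin n → Carrier → Carrier} → (∀ i → IsPolynomial (f i)) →
           IsPolynomial (λ x → Π n (λ i → f i x))
  poly-Π zero    p = poly-const 1#
  poly-Π (suc n) p = poly-* (p zero) (poly-Π n (p ∘ suc))

  poly-det : ∀ n {M : Carrier → Mat n} → (∀ i j → IsPolynomial (λ x → M x i j)) →
             IsPolynomial (λ x → det (M x))
  poly-det zero    p = poly-const 1#
  poly-det (suc n) p = poly-Σ (suc n) (λ j →
    poly-scale (sgn (toℕ j)) (poly-* (p zero j) (poly-det n (λ a b → p (suc a) (punchIn j b)))))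

  -- Polynomials that vanish at enough points

  *-cancel-0 : ∀ {a b} → ¬ (a ≈ 0#) → a * b ≈ 0# → b ≈ 0#
  *-cancel-0 {a} {b} a≉0 p = begin
    b                          ≈⟨ sym (*-identityˡ b) ⟩
    1# * b                     ≈⟨ *-congʳ (sym (inverseʳ a a≉0)) ⟩
    (a * inverse a a≉0) * b    ≈⟨ solve 3 (λ x y z → (x :* y) :* z := y :* (x :* z)) refl _ _ _ ⟩
    inverse a a≉0 * (a * b)    ≈⟨ trans (*-congˡ p) (zeroʳ _) ⟩
    0# ∎

  x+[y-x]≈y : ∀ x y → x + (y − x) ≈ y
  x+[y-x]≈y x y = begin
    x + (y + - x)  ≈⟨ solve 3 (λ x y z → x :+ (y :+ z) := y :+ (x :+ z)) refl x y (- x) ⟩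
    y + (x + - x)  ≈⟨ trans (+-congˡ (-‿inverseʳ x)) (+-identityʳ y) ⟩
    y ∎

  x-y≈0⇒x≈y : ∀ {x y} → x − y ≈ 0# → x ≈ y
  x-y≈0⇒x≈y {x} {y} p = trans (sym (x+[y-x]≈y y x)) (trans (+-congˡ p) (+-identityʳ y))

  -- Synthetic division: quotient r as are the coefficients of (p − p(r)) / (X − r) for every p = a ∷ as.
  quotient : Carrier → List Carrier → List Carrier
  quotient r []        = []
  quotient r (b ∷ₗ bs) = eval (b ∷ₗ bs) r ∷ₗ quotient r bs

  length-quotient : ∀ r as → length (quotient r as) ≡ length as
  length-quotient r []        = ≡.refl
  length-quotient r (b ∷ₗ bs) = ≡.cong suc (length-quotient r bs)

  eval-quotient : ∀ r as x → x * eval as x ≈ r * eval as r + (x − r) * eval (quotient r as) x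
  eval-quotient r []        x = trans (zeroʳ x) (sym (trans (+-cong (zeroʳ r) (zeroʳ _)) (+-identityˡ 0#)))
  eval-quotient r (b ∷ₗ bs) x = begin
    x * (b + x * eval bs x)
      ≈⟨ *-congˡ (+-congˡ (eval-quotient r bs x)) ⟩
    x * (b + (r * eval bs r + d * t))
      ≈⟨ solve 5 (λ x b s d t → x :* (b :+ (s :+ d :* t)) := x :* (b :+ s) :+ d :* (x :* t)) refl
           x b (r * eval bs r) d t ⟩
    x * e + d * (x * t)
      ≈⟨ +-congʳ (*-congʳ (sym (x+[y-x]≈y r x))) ⟩
    (r + d) * e + d * (x * t)
      ≈⟨ solve 5 (λ r d e x t → (r :+ d) :* e :+ d :* (x :* t) := r :* e :+ d :* (e :+ x :* t)) refl
           r d e x t ⟩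
    r * e + d * (e + x * t) ∎
    where
    d e t : Carrier
    d = x − r
    e = b + r * eval bs r
    t = eval (quotient r bs) x

  module _ (char0 : CharZero) where

    -- The root m is divided out. In characteristic zero the factor x - m is nonzero at m + 1, m +
    -- 2, ..., so the quotient vanishes there and induction applies. The bound `n` carries the
    -- recursion, as the shorter list `quotient r as` is not a sublist.
    eval-zero : ∀ n as → length as ≡ n → ∀ m → (∀ k → eval as (fromℕ (m +ℕ k)) ≈ 0#) →
                ∀ x → eval as x ≈ 0#
    eval-zero n       []        e m p x = refl
    eval-zero (suc n) (a ∷ₗ as) e m p x =
      trans (divide x) (trans (*-congˡ (eval-zero n (quotient r as)
        (≡.trans (length-quotient r as) (suc-injective e)) (suc m) q-vanish x)) (zeroʳ _))
      where
      r : Carrier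
      r = fromℕ m
      divide : ∀ x → eval (a ∷ₗ as) x ≈ (x − r) * eval (quotient r as) x
      divide x = begin
        a + x * eval as x
          ≈⟨ +-congˡ (eval-quotient r as x) ⟩
        a + (r * eval as r + (x − r) * eval (quotient r as) x)
          ≈⟨ sym (+-assoc _ _ _) ⟩
        eval (a ∷ₗ as) r + (x − r) * eval (quotient r as) x
          ≈⟨ +-congʳ (trans (reflexive (≡.cong (eval (a ∷ₗ as) ∘ fromℕ) (≡.sym (+-identityʳℕ m)))) (p 0)) ⟩
        0# + (x − r) * eval (quotient r as) x
          ≈⟨ +-identityˡ _ ⟩
        (x − r) * eval (quotient r as) x ∎
      q-vanish : ∀ k → eval (quotient r as) (fromℕ (suc m +ℕ k)) ≈ 0#
      q-vanish k = *-cancel-0 {fromℕ (suc m +ℕ k) − r}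
        (λ z → m≢1+m+n m (≡.sym (char0 (suc m +ℕ k) m (x-y≈0⇒x≈y z))))
        (trans (sym (divide (fromℕ (suc m +ℕ k))))
          (trans (reflexive (≡.cong (eval (a ∷ₗ as) ∘ fromℕ) (≡.sym (+-suc m k)))) (p (suc k))))

    -- Sampling starts at 1 so that users may cancel the sample point, as in `eval-subst-zero`, or
    -- invert it, as in `det-linear`.
    poly-zero : ∀ {f} → IsPolynomial f → (∀ k → f (fromℕ (suc k)) ≈ 0#) → ∀ x → f x ≈ 0#
    poly-zero (as , p) q x =
      trans (p x) (eval-zero (length as) as ≡.refl 1 (λ k → trans (sym (p _)) (q k)) x)

    poly-agree : ∀ {f g} → IsPolynomial f → IsPolynomial g →
                 (∀ k → f (fromℕ (suc k)) ≈ g (fromℕ (suc k))) → ∀ x → f x ≈ g x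
    poly-agree p q e x = x-y≈0⇒x≈y (poly-zero
      (poly-− p q)
      (λ k → trans (+-congʳ (e k)) (-‿inverseʳ _)) x)

    fromℕ-suc≉0 : ∀ k → ¬ (fromℕ (suc k) ≈ 0#)
    fromℕ-suc≉0 k z with () ← char0 (suc k) 0 z

    -- A nonzero polynomial g has a lowest coefficient, and the substitution k + s k² = k (1 + s k)
    -- preserves it; no root of 1 + s k has to be excluded.
    eval-subst-zero : ∀ s as j →
      (∀ k → (1# + s * k) ^ j * eval as (k + s * (k * k)) ≈ 0#) → ∀ e → eval as e ≈ 0#
    eval-subst-zero s []        j p e = refl
    eval-subst-zero s (a ∷ₗ as) j p e =
      trans (+-cong a≈0 (trans (*-congˡ (eval-subst-zero s as (suc j) R-zero e)) (zeroʳ e))) (+-identityˡ 0#)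
      where
      one^ : ∀ j → (1# + s * 0#) ^ j ≈ 1#
      one^ zero    = refl
      one^ (suc j) = trans (*-cong (trans (+-congˡ (zeroʳ s)) (+-identityʳ 1#)) (one^ j)) (*-identityˡ 1#)
      -- At k = 0 the weight is 1 and k + s k² is 0, which isolates the constant coefficient.
      a≈0 : a ≈ 0#
      a≈0 = begin
        a
          ≈⟨ sym (trans (+-congˡ (trans (*-congʳ zero-subst) (zeroˡ _))) (+-identityʳ a)) ⟩
        a + (0# + s * (0# * 0#)) * eval as (0# + s * (0# * 0#))
          ≈⟨ sym (trans (*-congʳ (one^ j)) (*-identityˡ _)) ⟩
        (1# + s * 0#) ^ j * (a + (0# + s * (0# * 0#)) * eval as (0# + s * (0# * 0#)))
          ≈⟨ p 0# ⟩
        0# ∎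
        where
        zero-subst : 0# + s * (0# * 0#) ≈ 0#
        zero-subst = trans (+-identityˡ _) (trans (*-congˡ (zeroʳ 0#)) (zeroʳ s))
      -- With `a` gone, a factor k (1 + s k) splits off: k is to be cancelled and 1 + s k joins the
      -- weight, raising its exponent.
      R : Carrier → Carrier
      R k = (1# + s * k) ^ suc j * eval as (k + s * (k * k))
      k*R : ∀ k → k * R k ≈ 0#
      k*R k = begin
        k * (((1# + s * k) * (1# + s * k) ^ j) * eval as (k + s * (k * k)))
          ≈⟨ solve 4 (λ k s w t → k :* (((con 1 :+ s :* k) :* w) :* t) := w :* (con 0 :+ (k :+ s :* (k :* k)) :* t))
               refl k s _ _ ⟩
        (1# + s * k) ^ j * (0# + (k + s * (k * k)) * eval as (k + s * (k * k)))
          ≈⟨ *-congˡ (+-congʳ (sym a≈0)) ⟩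
        (1# + s * k) ^ j * (a + (k + s * (k * k)) * eval as (k + s * (k * k)))
          ≈⟨ p k ⟩
        0# ∎
      R-zero : ∀ k → R k ≈ 0#
      -- The factor k cannot be cancelled at an arbitrary k, but it can at positive integers, and
      -- `R` is a polynomial.
      R-zero = poly-zero
        (poly-* (poly-^ (suc j) (poly-+ (poly-const 1#) (poly-scale s poly-id)))
          (poly-∘ as (poly-+ poly-id (poly-scale s (poly-* poly-id poly-id)))))
        (λ k → *-cancel-0 (fromℕ-suc≉0 k) (k*R (fromℕ (suc k))))

  -- Determinants of linear and quadratic expressions in a matrix

  -‿+ : ∀ a b → - (a + b) ≈ - a + - b
  -‿+ a b = sym (-‿+-comm a b)

  if≈*⟦⟧ : ∀ b y → (if b then y else 0#) ≈ y * ⟦ b ⟧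
  if≈*⟦⟧ true  y = sym (*-identityʳ y)
  if≈*⟦⟧ false y = sym (zeroʳ y)

  det-scale : ∀ n s (M : Mat n) → det (λ i j → s * M i j) ≈ s ^ n * det M
  det-scale zero    s M = sym (*-identityˡ 1#)
  det-scale (suc n) s M = trans
    (Σ-cong (suc n) {λ j → sgn (toℕ j) * ((s * M zero j) * det (λ a b → s * M (suc a) (punchIn j b)))}
      (λ j → trans
        (*-congˡ {x = sgn (toℕ j)} (*-congˡ {x = s * M zero j} (det-scale n s (λ a b → M (suc a) (punchIn j b)))))
        (solve 5 (λ g s a w d → g :* ((s :* a) :* (w :* d)) := (s :* w) :* (g :* (a :* d))) refl
          (sgn (toℕ j)) s (M zero j) (s ^ n) (det (λ a b → M (suc a) (punchIn j b))))))
    (sym (*-Σ (suc n) (s ^ suc n) (λ j → sgn (toℕ j) * (M zero j * det (λ a b → M (suc a) (punchIn j b))))))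

  Π-scale : ∀ n s (f : Fin n → Carrier) → Π n (λ i → s * f i) ≈ s ^ n * Π n f
  Π-scale zero    s f = sym (*-identityˡ 1#)
  Π-scale (suc n) s f = trans (*-congˡ (Π-scale n s (f ∘ suc)))
    (solve 4 (λ s a w p → (s :* a) :* (w :* p) := (s :* w) :* (a :* p)) refl _ _ _ _)

  charMat≈ : ∀ {n} y (M : Mat n) i j → charMat y M i j ≈ y * I i j − M i j
  charMat≈ y M i j = +-congʳ (if≈*⟦⟧ (does (i ≟ j)) y)

  module _ (char0 : CharZero) {n} (M : Mat n) (m : Fin n → Carrier)
           (split : ∀ y → φ M y ≈ Π n (λ i → y − m i)) where

    -- For invertible b the matrix is -b (yI - M) with y = -a/b, so the splitting hypothesis applies
    -- at y. Positive integers b suffice, both sides being polynomials in b.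
    det-linear : ∀ a b → det (λ i j → a * I i j + b * M i j) ≈ Π n (λ i → a + b * m i)
    det-linear a = poly-agree char0
      (poly-det n (λ i j → poly-+ (poly-const _) (poly-* poly-id (poly-const _))))
      (poly-Π n (λ i → poly-+ (poly-const _) (poly-* poly-id (poly-const _))))
      (λ k → invertible (fromℕ (suc k)) (inverse _ (fromℕ-suc≉0 char0 k)) (inverseʳ _ _))
      where
      invertible : ∀ b b⁻¹ → b * b⁻¹ ≈ 1# →
                   det (λ i j → a * I i j + b * M i j) ≈ Π n (λ i → a + b * m i)
      invertible b b⁻¹ bb⁻¹≈1 = begin
        det (λ i j → a * I i j + b * M i j)
          ≈⟨ det-cong (λ i j → sym (trans (*-congˡ (charMat≈ y M i j)) (homogenize (I i j) (M i j)))) ⟩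
        det (λ i j → - b * charMat y M i j)
          ≈⟨ det-scale n (- b) (charMat y M) ⟩
        (- b) ^ n * φ M y
          ≈⟨ *-congˡ (split y) ⟩
        (- b) ^ n * Π n (λ i → y − m i)
          ≈⟨ sym (Π-scale n (- b) (λ i → y − m i)) ⟩
        Π n (λ i → - b * (y − m i))
          ≈⟨ Π-cong n (λ i → trans (*-congˡ (+-congʳ (sym (*-identityʳ y))))
               (trans (homogenize 1# (m i)) (+-congʳ (*-identityʳ a)))) ⟩
        Π n (λ i → a + b * m i) ∎
        where
        y : Carrier
        y = - (a * b⁻¹)
        homogenize : ∀ s t → - b * (y * s − t) ≈ a * s + b * t
        homogenize s t = begin
          - b * (y * s + - t)
            ≈⟨ *-congˡ (+-congʳ (sym (-‿distribˡ-* (a * b⁻¹) s))) ⟩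
          - b * (- ((a * b⁻¹) * s) + - t)
            ≈⟨ *-congˡ (-‿+-comm _ t) ⟩
          - b * - ((a * b⁻¹) * s + t)
            ≈⟨ trans (sym (-‿distribˡ-* b _)) (trans (-‿cong (sym (-‿distribʳ-* b _))) (-‿involutive _)) ⟩
          b * ((a * b⁻¹) * s + t)
            ≈⟨ solve 5 (λ a b c s t → b :* ((a :* c) :* s :+ t) := (b :* c) :* (a :* s) :+ b :* t) refl a b b⁻¹ s t ⟩
          (b * b⁻¹) * (a * s) + b * t
            ≈⟨ +-congʳ (trans (*-congʳ bb⁻¹≈1) (*-identityˡ _)) ⟩
          a * s + b * t ∎

    -- The polynomial k + s k² − t − s t² in t has the root k, hence factors as
    -- (k − t) ((1 + s k) + s t); x, y, z stand for t⁰, t¹, t².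
    factor : ∀ s k x y z →
      k * ((1# + s * k) * x + s * y) + - 1# * ((1# + s * k) * y + s * z)
        ≈ ((k + s * (k * k)) * x − y) − s * z
    factor s k x y z = begin
      k * ((1# + s * k) * x + s * y) + - 1# * ((1# + s * k) * y + s * z)
        ≈⟨ solve 6 (λ s k x y z u →
             k :* ((con 1 :+ s :* k) :* x :+ s :* y) :+ u :* ((con 1 :+ s :* k) :* y :+ s :* z)
             := (((k :+ s :* (k :* k)) :* x :+ u :* y) :+ u :* (s :* z)) :+ (con 1 :+ u) :* ((s :* k) :* y))
             refl s k x y z (- 1#) ⟩
      (((k + s * (k * k)) * x + - 1# * y) + - 1# * (s * z)) + (1# + - 1#) * ((s * k) * y)
        ≈⟨ +-cong (+-cong (+-congˡ (-1*x≈-x y)) (-1*x≈-x (s * z)))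
             (trans (*-congʳ (-‿inverseʳ 1#)) (zeroˡ _)) ⟩
      (((k + s * (k * k)) * x − y) − s * z) + 0#
        ≈⟨ +-identityʳ _ ⟩
      ((k + s * (k * k)) * x − y) − s * z ∎

    det-quadratic : ∀ s e →
      det (λ i j → (e * I i j − M i j) − s * (M · M) i j) ≈ Π n (λ i → (e − m i) − s * (m i * m i))
    det-quadratic s e = x-y≈0⇒x≈y (trans (proj₂ difference e)
      -- The exponent 0 makes the initial weight equal to 1.
      (eval-subst-zero char0 s (proj₁ difference) 0
        (λ k → trans (*-identityˡ _) (trans (sym (proj₂ difference _)) (trans (+-congʳ (split-case k)) (-‿inverseʳ _)))) e))
      where
      lhs rhs : Carrier → Carrier
      lhs e = det (λ i j → (e * I i j − M i j) − s * (M · M) i j)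
      rhs e = Π n (λ i → (e − m i) − s * (m i * m i))

      difference : IsPolynomial (λ e → lhs e − rhs e)
      difference = poly-−
        (poly-det n (λ i j → poly-− (poly-− (poly-* poly-id (poly-const _)) (poly-const _)) (poly-const _)))
        (poly-Π n (λ i → poly-− (poly-− poly-id (poly-const _)) (poly-const _)))

      split-case : ∀ k → lhs (k + s * (k * k)) ≈ rhs (k + s * (k * k))
      split-case k = begin
        lhs (k + s * (k * k))
          ≈⟨ sym (det-cong matrix-factor) ⟩
        det (P · P′)
          ≈⟨ det-· P P′ ⟩
        det P * det P′
          ≈⟨ *-cong (det-linear k (- 1#)) (det-linear p s) ⟩
        Π n (λ i → k + - 1# * m i) * Π n (λ i → p + s * m i)
          ≈⟨ Π-* n _ _ ⟩
        Π n (λ i → (k + - 1# * m i) * (p + s * m i))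
          ≈⟨ Π-cong n (λ i → trans
               (solve 5 (λ k u t p s → (k :+ u :* t) :* (p :+ s :* t)
                 := k :* (p :* con 1 :+ s :* t) :+ u :* (p :* t :+ s :* (t :* t))) refl k (- 1#) (m i) p s)
               (trans (factor s k 1# (m i) (m i * m i)) (+-congʳ (+-congʳ (*-identityʳ _))))) ⟩
        rhs (k + s * (k * k)) ∎
        where
        p : Carrier
        p = 1# + s * k
        -- The factors k - t and (1 + s k) + s t at t = M. The identity `factor` is linear in the
        -- powers of t, so it applies to matrix entries and to eigenvalues alike.
        P P′ : Mat n
        P  i j = k * I i j + - 1# * M i j
        P′ i j = p * I i j + s * M i j
        matrix-factor : ∀ i j → (P · P′) i j ≈ ((k + s * (k * k)) * I i j − M i j) − s * (M · M) i j
        matrix-factor i j = begin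
          Σ n (λ l → (k * I i l + - 1# * M i l) * P′ l j)
            ≈⟨ Σ-cong n (λ l → trans (distribʳ (P′ l j) _ _)
                 (+-cong (*-assoc k (I i l) (P′ l j)) (*-assoc (- 1#) (M i l) (P′ l j)))) ⟩
          Σ n (λ l → k * (I i l * P′ l j) + - 1# * (M i l * P′ l j))
            ≈⟨ trans (Σ-+ n _ _) (sym (+-cong (*-Σ n k _) (*-Σ n (- 1#) _))) ⟩
          k * Σ n (λ l → I i l * P′ l j) + - 1# * Σ n (λ l → M i l * P′ l j)
            ≈⟨ +-cong (*-congˡ (Σ-Iˡ n i (λ l → P′ l j))) (*-congˡ (begin
              Σ n (λ l → M i l * (p * I l j + s * M l j))
                ≈⟨ Σ-cong n (λ l → solve 5 (λ a p b s d → a :* (p :* b :+ s :* d) := p :* (a :* b) :+ s :* (a :* d))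
                     refl (M i l) p (I l j) s (M l j)) ⟩
              Σ n (λ l → p * (M i l * I l j) + s * (M i l * M l j))
                ≈⟨ trans (Σ-+ n _ _) (sym (+-cong (*-Σ n p _) (*-Σ n s _))) ⟩
              p * Σ n (λ l → M i l * I l j) + s * (M · M) i j
                ≈⟨ +-congʳ (*-congˡ (Σ-Iʳ n j (M i))) ⟩
              p * M i j + s * (M · M) i j ∎)) ⟩
          k * (p * I i j + s * M i j) + - 1# * (p * M i j + s * (M · M) i j)
            ≈⟨ factor s k (I i j) (M i j) ((M · M) i j) ⟩
          ((k + s * (k * k)) * I i j − M i j) − s * (M · M) i j ∎

  -- Signless Laplacians and the corona

  fromℕ-+ : ∀ m n → fromℕ (m +ℕ n) ≈ fromℕ m + fromℕ n
  fromℕ-+ zero    n = sym (+-identityˡ _)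
  fromℕ-+ (suc m) n = trans (+-congˡ (fromℕ-+ m n)) (sym (+-assoc _ _ _))

  fromℕ-* : ∀ m n → fromℕ (m *ℕ n) ≈ fromℕ m * fromℕ n
  fromℕ-* zero    n = sym (zeroˡ _)
  fromℕ-* (suc m) n = trans (fromℕ-+ n (m *ℕ n)) (trans
    (+-cong (sym (*-identityˡ _)) (fromℕ-* m n)) (sym (distribʳ _ _ _)))

  fromℕ-if : ∀ b d → fromℕ (if b then d else 0) ≈ fromℕ d * ⟦ b ⟧
  fromℕ-if true  d = sym (*-identityʳ _)
  fromℕ-if false d = sym (zeroʳ _)

  fromℕ-⟦⟧ : ∀ b → fromℕ (if b then 1 else 0) ≈ ⟦ b ⟧
  fromℕ-⟦⟧ true  = +-identityʳ 1#
  fromℕ-⟦⟧ false = refl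

  ⟦∧⟧ : ∀ b b′ → ⟦ b ∧ b′ ⟧ ≈ ⟦ b ⟧ * ⟦ b′ ⟧
  ⟦∧⟧ true  b′ = sym (*-identityˡ _)
  ⟦∧⟧ false b′ = sym (zeroˡ _)

  Σ-const : ∀ n a → Σ n (λ _ → a) ≈ fromℕ n * a
  Σ-const zero    a = sym (zeroˡ a)
  Σ-const (suc n) a = trans (+-cong (sym (*-identityˡ a)) (Σ-const n a)) (sym (distribʳ a _ _))

  fromℕ-degree : ∀ {n} (a : Fin n → Fin n → Bool) i → fromℕ (degreeOf a i) ≈ Σ n (λ j → ⟦ a i j ⟧)
  fromℕ-degree {n} a i = go n (a i)
    where
    go : ∀ n (p : Fin n → Bool) → fromℕ (sumℕ n (λ j → if p j then 1 else 0)) ≈ Σ n (λ j → ⟦ p j ⟧)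
    go zero    p = refl
    go (suc n) p = trans (fromℕ-+ (if p zero then 1 else 0) (sumℕ n (λ j → if p (suc j) then 1 else 0)))
      (+-cong (fromℕ-⟦⟧ (p zero)) (go n (p ∘ suc)))

  -- Stated for a bare adjacency function, so as to serve the corona as well as `G1` and `G2`.
  charMat-QOf : ∀ {n} (a : Fin n → Fin n → Bool) x i j →
                charMat x (matℕ (QOf a)) i j ≈ (x − fromℕ (degreeOf a i)) * I i j − ⟦ a i j ⟧
  charMat-QOf a x i j = begin
    charMat x (matℕ (QOf a)) i j
      ≈⟨ charMat≈ x (matℕ (QOf a)) i j ⟩
    x * I i j + - fromℕ (QOf a i j)
      ≈⟨ +-congˡ (-‿cong (trans (fromℕ-+ (if does (i ≟ j) then degreeOf a i else 0) _)
           (+-cong (fromℕ-if (does (i ≟ j)) d) (fromℕ-⟦⟧ (a i j))))) ⟩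
    x * I i j + - (fromℕ d * I i j + ⟦ a i j ⟧)
      ≈⟨ +-congˡ (trans (-‿+ _ _) (+-congʳ (-‿distribˡ-* (fromℕ d) (I i j)))) ⟩
    x * I i j + (- fromℕ d * I i j + - ⟦ a i j ⟧)
      ≈⟨ solve 4 (λ x t d e → x :* t :+ (d :* t :+ e) := (x :+ d) :* t :+ e) refl x (I i j) (- fromℕ d) (- ⟦ a i j ⟧) ⟩
    (x − fromℕ d) * I i j − ⟦ a i j ⟧ ∎
    where
    d : ℕ
    d = degreeOf a i

  module _ {n1 n2 : ℕ} (G1 : Graph n1) (G2 : Graph n2) where

    base : Fin n1 → Fin (n1 +ℕ n1 *ℕ n2)
    base a = a ↑ˡ (n1 *ℕ n2)

    copy : Fin n1 → Fin n2 → Fin (n1 +ℕ n1 *ℕ n2)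
    copy i j = n1 ↑ʳ combine i j

    corona-base-base : ∀ a b → coronaAdj G1 G2 (base a) (base b) ≡ adj G1 a b
    corona-base-base a b rewrite splitAt-↑ˡ n1 a (n1 *ℕ n2) | splitAt-↑ˡ n1 b (n1 *ℕ n2) = ≡.refl

    corona-base-copy : ∀ a i j → coronaAdj G1 G2 (base a) (copy i j) ≡ adj G1 a i
    corona-base-copy a i j
      rewrite splitAt-↑ˡ n1 a (n1 *ℕ n2) | splitAt-↑ʳ n1 (n1 *ℕ n2) (combine i j)
      = ≡.cong (λ q → adj G1 a (proj₁ q)) (remQuot-combine i j)

    corona-copy-base : ∀ i j b → coronaAdj G1 G2 (copy i j) (base b) ≡ adj G1 i b
    corona-copy-base i j b
      rewrite splitAt-↑ˡ n1 b (n1 *ℕ n2) | splitAt-↑ʳ n1 (n1 *ℕ n2) (combine i j)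
      = ≡.cong (λ q → adj G1 (proj₁ q) b) (remQuot-combine i j)

    corona-copy-copy : ∀ i j i′ j′ →
      coronaAdj G1 G2 (copy i j) (copy i′ j′) ≡ does (i ≟ i′) ∧ adj G2 j j′
    corona-copy-copy i j i′ j′
      rewrite splitAt-↑ʳ n1 (n1 *ℕ n2) (combine i j) | splitAt-↑ʳ n1 (n1 *ℕ n2) (combine i′ j′)
      = ≡.cong₂ (λ q q′ → does (proj₁ q ≟ proj₁ q′) ∧ adj G2 (proj₂ q) (proj₂ q′))
          (remQuot-combine i j) (remQuot-combine i′ j′)

    Σ-corona : ∀ (f : Fin (n1 +ℕ n1 *ℕ n2) → Carrier) →
      Σ (n1 +ℕ n1 *ℕ n2) f ≈ Σ n1 (λ b → f (base b)) + Σ n1 (λ i → Σ n2 (λ j → f (copy i j)))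
    Σ-corona f = trans (Σ-split n1 (n1 *ℕ n2) f) (+-congˡ (Σ-combine n1 n2 (λ k → f (n1 ↑ʳ k))))

    I-base : ∀ a b → I (base a) (base b) ≈ I a b
    I-base = I-injective base (↑ˡ-injective (n1 *ℕ n2))

    base≢ : ∀ a k → base a ≢ n1 ↑ʳ k
    base≢ a k e with () ← ≡.trans (≡.sym (splitAt-↑ˡ n1 a (n1 *ℕ n2)))
      (≡.trans (≡.cong (splitAt n1) e) (splitAt-↑ʳ n1 (n1 *ℕ n2) k))

    I-copy : ∀ i j i′ j′ → I (copy i j) (copy i′ j′) ≈ I i i′ * I j j′
    I-copy i j i′ j′ with i ≟ i′ | j ≟ j′
    ... | yes ≡.refl | yes ≡.refl = trans (I-diag (copy i j)) (sym (*-identityˡ 1#))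
    ... | no i≢i′ | _ = trans
      (I-off (λ e → i≢i′ (proj₁ (combine-injective i j i′ j′ (↑ʳ-injective n1 _ _ e))))) (sym (zeroˡ _))
    ... | yes _ | no j≢j′ = trans
      (I-off (λ e → j≢j′ (proj₂ (combine-injective i j i′ j′ (↑ʳ-injective n1 _ _ e))))) (sym (zeroʳ _))

    module _ {r1 : ℕ} (regular : Regular r1 G1) where

      r : Carrier
      r = fromℕ r1

      A : Mat n1
      A i j = ⟦ adj G1 i j ⟧

      Σ-A : ∀ i → Σ n1 (A i) ≈ r
      Σ-A i = trans (sym (fromℕ-degree (adj G1) i)) (reflexive (≡.cong fromℕ (regular i)))

      -- Each of the r1 neighbours of `a` in `G1` counts once itself and contributes the n2 vertices
      -- of its copy of `G2`.
      degree-base : ∀ a → fromℕ (degreeOf (coronaAdj G1 G2) (base a)) ≈ r + fromℕ (n2 *ℕ r1)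
      degree-base a = begin
        fromℕ (degreeOf (coronaAdj G1 G2) (base a))
          ≈⟨ trans (fromℕ-degree (coronaAdj G1 G2) (base a)) (Σ-corona _) ⟩
        Σ n1 (λ b → ⟦ coronaAdj G1 G2 (base a) (base b) ⟧)
          + Σ n1 (λ i → Σ n2 (λ j → ⟦ coronaAdj G1 G2 (base a) (copy i j) ⟧))
          ≈⟨ +-cong (Σ-cong n1 (λ b → reflexive (≡.cong ⟦_⟧ (corona-base-base a b))))
               (Σ-cong n1 (λ i → trans (Σ-cong n2 (λ j → reflexive (≡.cong ⟦_⟧ (corona-base-copy a i j))))
                 (Σ-const n2 (A a i)))) ⟩
        Σ n1 (A a) + Σ n1 (λ i → fromℕ n2 * A a i)
          ≈⟨ +-cong (Σ-A a) (trans (sym (*-Σ n1 (fromℕ n2) (A a)))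
               (trans (*-congˡ (Σ-A a)) (sym (fromℕ-* n2 r1)))) ⟩
        r + fromℕ (n2 *ℕ r1) ∎

      -- The r1 neighbours of vertex i raise every degree in its copy equally; this is why Q(G2) is
      -- taken at x - r1.
      degree-copy : ∀ i j → fromℕ (degreeOf (coronaAdj G1 G2) (copy i j)) ≈ r + fromℕ (degree G2 j)
      degree-copy i j = begin
        fromℕ (degreeOf (coronaAdj G1 G2) (copy i j))
          ≈⟨ trans (fromℕ-degree (coronaAdj G1 G2) (copy i j)) (Σ-corona _) ⟩
        Σ n1 (λ b → ⟦ coronaAdj G1 G2 (copy i j) (base b) ⟧)
          + Σ n1 (λ i′ → Σ n2 (λ j′ → ⟦ coronaAdj G1 G2 (copy i j) (copy i′ j′) ⟧))
          ≈⟨ +-cong (Σ-cong n1 (λ b → reflexive (≡.cong ⟦_⟧ (corona-copy-base i j b))))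
               (Σ-cong n1 (λ i′ → trans
                 (Σ-cong n2 (λ j′ → trans (reflexive (≡.cong ⟦_⟧ (corona-copy-copy i j i′ j′)))
                   (⟦∧⟧ (does (i ≟ i′)) (adj G2 j j′))))
                 (sym (*-Σ n2 (I i i′) _)))) ⟩
        Σ n1 (A i) + Σ n1 (λ i′ → I i i′ * Σ n2 (λ j′ → ⟦ adj G2 j j′ ⟧))
          ≈⟨ +-cong (Σ-A i) (trans (Σ-Iˡ n1 i _) (sym (fromℕ-degree (adj G2) j))) ⟩
        r + fromℕ (degree G2 j) ∎

      -- The Schur complement of the copies of G2

      module _ (x : Carrier) where

        K : Mat (n1 +ℕ n1 *ℕ n2)
        K = charMat x (matℕ (Qcorona G1 G2))

        C : Mat n2
        C = charMat (x − r) (matℕ (Q G2))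

        K-entry : ∀ u v → K u v ≈ (x − fromℕ (degreeOf (coronaAdj G1 G2) u)) * I u v − ⟦ coronaAdj G1 G2 u v ⟧
        K-entry = charMat-QOf (coronaAdj G1 G2) x

        K-off : ∀ {u v b} → u ≢ v → coronaAdj G1 G2 u v ≡ b → K u v ≈ - ⟦ b ⟧
        K-off {u} {v} u≢v e = trans (K-entry u v) (trans
          (+-cong (trans (*-congˡ (I-off u≢v)) (zeroʳ _)) (-‿cong (reflexive (≡.cong ⟦_⟧ e)))) (+-identityˡ _))

        K-base-base : ∀ a b → K (base a) (base b) ≈ (x − (r + fromℕ (n2 *ℕ r1))) * I a b − A a b
        K-base-base a b = trans (K-entry (base a) (base b))
          (+-cong (*-cong (+-congˡ (-‿cong (degree-base a))) (I-base a b))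
            (-‿cong (reflexive (≡.cong ⟦_⟧ (corona-base-base a b)))))

        K-base-copy : ∀ a i j → K (base a) (copy i j) ≈ - A a i
        K-base-copy a i j = K-off (base≢ a (combine i j)) (corona-base-copy a i j)

        K-copy-base : ∀ i j b → K (copy i j) (base b) ≈ - A i b
        K-copy-base i j b = K-off (λ e → base≢ b (combine i j) (≡.sym e)) (corona-copy-base i j b)

        K-copy-copy : ∀ i j i′ j′ → K (copy i j) (copy i′ j′) ≈ I i i′ * C j j′
        K-copy-copy i j i′ j′ = begin
          K (copy i j) (copy i′ j′)
            ≈⟨ K-entry (copy i j) (copy i′ j′) ⟩
          (x − fromℕ (degreeOf (coronaAdj G1 G2) (copy i j))) * I (copy i j) (copy i′ j′)
            − ⟦ coronaAdj G1 G2 (copy i j) (copy i′ j′) ⟧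
            ≈⟨ +-cong (*-cong (+-congˡ (trans (-‿cong (degree-copy i j)) (-‿+ r d))) (I-copy i j i′ j′))
                 (-‿cong (trans (reflexive (≡.cong ⟦_⟧ (corona-copy-copy i j i′ j′))) (⟦∧⟧ (does (i ≟ i′)) _))) ⟩
          (x + (- r + - d)) * (I i i′ * I j j′) + - (I i i′ * ⟦ adj G2 j j′ ⟧)
            ≈⟨ +-congˡ (-‿distribʳ-* (I i i′) ⟦ adj G2 j j′ ⟧) ⟩
          (x + (- r + - d)) * (I i i′ * I j j′) + I i i′ * - ⟦ adj G2 j j′ ⟧
            ≈⟨ solve 6 (λ x r d s t a → (x :+ (r :+ d)) :* (s :* t) :+ s :* a := s :* (((x :+ r) :+ d) :* t :+ a))
                 refl x (- r) (- d) (I i i′) (I j j′) (- ⟦ adj G2 j j′ ⟧) ⟩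
          I i i′ * (((x − r) − d) * I j j′ − ⟦ adj G2 j j′ ⟧)
            ≈⟨ *-congˡ (sym (charMat-QOf (adj G2) (x − r) j j′)) ⟩
          I i i′ * C j j′ ∎
          where
          d : Carrier
          d = fromℕ (degree G2 j)

        module _ (N : Mat n2) (NC≈I : (N · C) ≈ₘ I) where

          -- The row vector 1ᵀN, with 1 the all-ones column.
          columnSum : Fin n2 → Carrier
          columnSum j = Σ n2 (λ k → N k j)

          columnSum·C : ∀ j → Σ n2 (λ l → columnSum l * C l j) ≈ 1#
          columnSum·C j = begin
            Σ n2 (λ l → columnSum l * C l j)
              ≈⟨ Σ-cong n2 (λ l → Σ-* n2 (λ k → N k l) (C l j)) ⟩
            Σ n2 (λ l → Σ n2 (λ k → N k l * C l j))
              ≈⟨ Σ-swap n2 n2 (λ l k → N k l * C l j) ⟩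
            Σ n2 (λ k → (N · C) k j)
              ≈⟨ Σ-cong n2 (λ k → trans (NC≈I k j) (sym (*-identityˡ _))) ⟩
            Σ n2 (λ k → 1# * I k j)
              ≈⟨ Σ-Iʳ n2 j (λ _ → 1#) ⟩
            1# ∎

          -- This is A ⊗ 1ᵀN. The upper right block of `K` is -(A ⊗ 1ᵀ), and X (I ⊗ C) has to be its
          -- negative A ⊗ 1ᵀ.
          X : Fin n1 → Fin (n1 *ℕ n2) → Carrier
          X a l = A a (proj₁ (remQuot {n1} n2 l)) * columnSum (proj₂ (remQuot {n1} n2 l))

          X-combine : ∀ a i j → X a (combine i j) ≈ A a i * columnSum j
          X-combine a i j = reflexive
            (≡.cong (λ q → A a (proj₁ q) * columnSum (proj₂ q)) (remQuot-combine {n1} {n2} i j))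

          X-clears : ∀ a i′ j′ →
            K (base a) (copy i′ j′) + Σ (n1 *ℕ n2) (λ l → X a l * K (n1 ↑ʳ l) (copy i′ j′)) ≈ 0#
          X-clears a i′ j′ = trans (+-cong (K-base-copy a i′ j′) (begin
            Σ (n1 *ℕ n2) (λ l → X a l * K (n1 ↑ʳ l) (copy i′ j′))
              ≈⟨ Σ-combine n1 n2 (λ l → X a l * K (n1 ↑ʳ l) (copy i′ j′)) ⟩
            Σ n1 (λ i → Σ n2 (λ j → X a (combine i j) * K (copy i j) (copy i′ j′)))
              ≈⟨ Σ-cong n1 (λ i → trans
                   (Σ-cong n2 (λ j → trans (*-cong (X-combine a i j) (K-copy-copy i j i′ j′))
                     (solve 4 (λ a t d e → (a :* t) :* (d :* e) := (a :* d) :* (t :* e)) refl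
                       (A a i) (columnSum j) (I i i′) (C j j′))))
                   (trans (sym (*-Σ n2 (A a i * I i i′) _))
                     (trans (*-congˡ (columnSum·C j′)) (*-identityʳ _)))) ⟩
            Σ n1 (λ i → A a i * I i i′)
              ≈⟨ Σ-Iʳ n1 i′ (A a) ⟩
            A a i′ ∎)) (-‿inverseˡ (A a i′))

          -- The lower left block is -(A ⊗ 1), so the product is -(1ᵀN1) A²; the coronal enters here
          -- as 1ᵀN1.
          X-complement : ∀ a b → Σ (n1 *ℕ n2) (λ l → X a l * K (n1 ↑ʳ l) (base b)) ≈ - (sumEntries N * (A · A) a b)
          X-complement a b = begin
            Σ (n1 *ℕ n2) (λ l → X a l * K (n1 ↑ʳ l) (base b))
              ≈⟨ Σ-combine n1 n2 (λ l → X a l * K (n1 ↑ʳ l) (base b)) ⟩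
            Σ n1 (λ i → Σ n2 (λ j → X a (combine i j) * K (copy i j) (base b)))
              ≈⟨ Σ-cong n1 (λ i → trans
                   (Σ-cong n2 (λ j → trans (*-cong (X-combine a i j) (K-copy-base i j b))
                     (trans (*-congˡ (sym (-1*x≈-x (A i b))))
                       (solve 4 (λ a t u b → (a :* t) :* (u :* b) := (u :* (a :* b)) :* t) refl
                         (A a i) (columnSum j) (- 1#) (A i b)))))
                   (sym (*-Σ n2 (- 1# * (A a i * A i b)) columnSum))) ⟩
            Σ n1 (λ i → (- 1# * (A a i * A i b)) * Σ n2 columnSum)
              ≈⟨ sym (Σ-* n1 (λ i → - 1# * (A a i * A i b)) (Σ n2 columnSum)) ⟩
            Σ n1 (λ i → - 1# * (A a i * A i b)) * Σ n2 columnSum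
              ≈⟨ *-cong (sym (*-Σ n1 (- 1#) (λ i → A a i * A i b))) (Σ-swap n2 n2 (λ j k → N k j)) ⟩
            (- 1# * (A · A) a b) * sumEntries N
              ≈⟨ solve 3 (λ u a s → (u :* a) :* s := u :* (s :* a)) refl (- 1#) ((A · A) a b) (sumEntries N) ⟩
            - 1# * (sumEntries N * (A · A) a b)
              ≈⟨ -1*x≈-x _ ⟩
            - (sumEntries N * (A · A) a b) ∎

          φ-corona-schur :
            φ (matℕ (Qcorona G1 G2)) x
              ≈ det (λ a b → ((x − (r + fromℕ (n2 *ℕ r1))) * I a b − A a b) − sumEntries N * (A · A) a b)
                * φ (matℕ (Q G2)) (x − r) ^ n1
          φ-corona-schur = trans
            (det-schur n1 (n1 *ℕ n2) K X (λ a → combine-elim n1 n2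
              (λ k → K (base a) (n1 ↑ʳ k) + Σ (n1 *ℕ n2) (λ l → X a l * K (n1 ↑ʳ l) (n1 ↑ʳ k)) ≈ 0#)
              (X-clears a)))
            (*-cong (det-cong (λ a b → +-cong (K-base-base a b) (X-complement a b)))
              (det-block-diagonal n1 (λ k l → K (n1 ↑ʳ k) (n1 ↑ʳ l)) C K-copy-copy))

      a-[b-c]≈[a+c]-b : ∀ a b c → a − (b − c) ≈ (a + c) − b
      a-[b-c]≈[a+c]-b a b c = begin
        a + - (b + - c)    ≈⟨ +-congˡ (trans (-‿+ b (- c)) (+-congˡ (-‿involutive c))) ⟩
        a + (- b + c)      ≈⟨ solve 3 (λ a b c → a :+ (b :+ c) := (a :+ c) :+ b) refl a (- b) c ⟩
        (a + c) + - b ∎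

      -- By regularity Q(G1) = A + rI, so the eigenvalues of `A` are those of Q(G1) lowered by r.
      φ-A-split : (ν : Fin n1 → Carrier) → (∀ y → φ (matℕ (Q G1)) y ≈ Π n1 (λ i → y − ν i)) →
                  ∀ y → φ A y ≈ Π n1 (λ i → y − (ν i − r))
      φ-A-split ν split y = begin
        φ A y
          ≈⟨ det-cong (λ i j → trans (charMat≈ y A i j) (trans (+-congʳ (*-congʳ (shift i)))
               (sym (charMat-QOf (adj G1) (y + r) i j)))) ⟩
        φ (matℕ (Q G1)) (y + r)
          ≈⟨ split (y + r) ⟩
        Π n1 (λ i → (y + r) − ν i)
          ≈⟨ Π-cong n1 (λ i → sym (a-[b-c]≈[a+c]-b y (ν i) r)) ⟩
        Π n1 (λ i → y − (ν i − r)) ∎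
        where
        shift : ∀ i → y ≈ (y + r) − fromℕ (degree G1 i)
        shift i = sym (trans (+-congˡ (-‿cong (reflexive (≡.cong fromℕ (regular i)))))
          (trans (+-assoc y r (- r)) (trans (+-congˡ (-‿inverseʳ r)) (+-identityʳ y))))

      φ-corona : CharZero → (ν : Fin n1 → Carrier) → (∀ y → φ (matℕ (Q G1)) y ≈ Π n1 (λ i → y − ν i)) →
        ∀ x N → IsResolvent (matℕ (Q G2)) (x − r) N →
        φ (matℕ (Qcorona G1 G2)) x
          ≈ (φ (matℕ (Q G2)) (x − r) ^ n1)
            * Π n1 (λ i → ((x − fromℕ (n2 *ℕ r1)) − ν i) − (sumEntries N * ((ν i − r) ^ 2)))
      φ-corona char0 ν split x N (_ , NC≈I) = trans (φ-corona-schur x N NC≈I) (trans (*-comm _ _) (*-congˡ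
        (trans (det-quadratic char0 A (λ i → ν i − r) (φ-A-split ν split) (sumEntries N) (x − (r + q)))
          (Π-cong n1 (λ i → +-cong (linear-part i)
            -- The square t ^ 2 unfolds to t * (t * 1#).
            (-‿cong (*-congˡ (*-congˡ (sym (*-identityʳ (ν i − r)))))))))))
        where
        q : Carrier
        q = fromℕ (n2 *ℕ r1)
        -- The r in the degree of a base vertex cancels against the shift from ν to ν - r.
        linear-part : ∀ i → (x − (r + q)) − (ν i − r) ≈ (x − q) − ν i
        linear-part i = trans (a-[b-c]≈[a+c]-b _ (ν i) r) (+-congʳ (begin
          (x + - (r + q)) + r      ≈⟨ +-congʳ (+-congˡ (-‿+ r q)) ⟩
          (x + (- r + - q)) + r    ≈⟨ solve 4 (λ x r q s → (x :+ (r :+ q)) :+ s := (x :+ q) :+ (s :+ r)) refl x (- r) (- q) r ⟩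
          (x + - q) + (r + - r)    ≈⟨ trans (+-congˡ (-‿inverseʳ r)) (+-identityʳ _) ⟩
          x − q ∎))

-- `N` is the inverse in the definition of the coronal, so `sumEntries N` is its value at x - r1.
-- With `F` a field of rational functions and `x` its variable this is the identity of rational
-- functions.
theorem2p5 : ∀ {c ℓ} (F : Field c ℓ) →
  let open FieldOps F in
  CharZero →
  (n1 n2 r1 : ℕ) → 2 ≤ n1 → 1 ≤ n2 → 1 ≤ r1 →
  (G1 : Graph n1) (G2 : Graph n2) → Regular r1 G1 →
  (ν : Fin n1 → Carrier) →
  (∀ y → φ (matℕ (Q G1)) y ≈ Π n1 (λ i → y − ν i)) →
  (x : Carrier) (N : Mat n2) →
  IsResolvent (matℕ (Q G2)) (x − fromℕ r1) N →
  φ (matℕ (Qcorona G1 G2)) x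
    ≈ (φ (matℕ (Q G2)) (x − fromℕ r1) ^ n1)
      * Π n1 (λ i → ((x − fromℕ (n2 *ℕ r1)) − ν i)
                     − (sumEntries N * ((ν i − fromℕ r1) ^ 2)))
theorem2p5 F char0 n1 n2 r1 _ _ _ G1 G2 regular ν split x N =
  FieldTheory.φ-corona F G1 G2 regular char0 ν split x N
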